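{- Let $\mathcal{R}$ be a finite valuation ring of order $q^r$, where $q$ is a power of an odd prime. There is an absolute-type constant $C>0$, depending only on $n$, such that for every integer $n>1$ and every set $\mathcal{A}\subset\mathcal{R}$ with $|\mathcal{A}|\ge 2q^{r-1}$, \[\max\left\{ |n\mathcal{A}^2|,\ |\mathcal{A}+\mathcal{A}|\right\}\ \ge\ C\min\left\{ q^{\frac{r}{n}}|\mathcal{A}|^{\frac{n-1}{n}},\ \frac{|\mathcal{A}|^{\frac{3n-2}{n}}}{q^{\frac{(n-1)(2r-1)}{n}}}\right\}.\]
   Context: A finite valuation ring is a finite, local, principal commutative ring with identity. Its unique maximal ideal is $(z)$ for a uniformizer $z$; the residue field $\mathcal{R}/(z)$ has $q$ elements; $r$ is the smallest positive integer with $z^r=0$; then $|\mathcal{R}|=q^r$ and $|(z)|=q^{r-1}$. For $\mathcal{A}\subset\mathcal{R}$: $\mathcal{A}+\mathcal{A}=\{a+b: a,b\in\mathcal{A}\}$, $\mathcal{A}^2=\{x^2: x\in\mathcal{A}\}$, and for a positive integer $n$, $n\mathcal{A}^2$ is the set of all sums $a_1+\cdots+a_n$ with $a_1,\dots,a_n\in\mathcal{A}^2$. -}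

module Defs where

open import Algebra.Bundles using (CommutativeRing; Semiring)
import Algebra.Definitions.RawMagma as RawMagmaDefinitions
import Algebra.Definitions.RawMonoid as RawMonoidDefinitions
import Algebra.Definitions.RawSemiring as RawSemiringDefinitions
open import Data.Fin.Base using (Fin)
import Data.Fin.Properties as Fin
open import Data.Fin.Subset using (Subset; _∈_; _⊆_; ⊤)
open import Data.Fin.Subset.Properties using (_∈?_)
open import Data.Integer.Base using (+_)
open import Data.Nat.Base using (ℕ; zero; suc; _<_; _≤_; _^_)
open import Data.Nat.Primality using (Prime)
open import Data.Product using (∃; ∃₂; ∃!; _×_; _,_)
open import Data.Rational.Base using (ℚ; _/_; +-*-rawSemiring)
open import Data.Sum.Base using (_⊎_)
open import Data.Vec.Base using (Vec; []; _∷_; lookup; tabulate)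
open import Function.Base using (_∘_)
open import Function.Bundles using (Inverse; _⇔_)
open import Function.Definitions using (Congruent; Bijective)
open import Level using (Level; _⊔_) renaming (suc to lsuc)
open import Relation.Binary.Definitions using () renaming (Decidable to Decidable₂)
open import Relation.Binary.PropositionalEquality using (_≡_; _≢_)
import Relation.Binary.PropositionalEquality as ≡
open import Relation.Nullary using (Dec; does)
open import Relation.Nullary.Decidable using (map′; _×-dec_)
open import Relation.Unary using (Pred; Decidable)

private
  variable
    p : Level
    m : ℕ

any-vec? : ∀ n {P : Pred (Vec (Fin m) n) p} → Decidable P → Dec (∃ P)
any-vec? zero    P? = map′ ([] ,_) (λ { ([] , h) → h }) (P? [])
any-vec? (suc n) P? =
  map′ (λ { (i , v , h) → i ∷ v , h })
       (λ { (i ∷ v , h) → i , v , h })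
       (Fin.any? λ i → any-vec? n λ v → P? (i ∷ v))

-- The enumeration provides codes in Fin order for the elements of the ring, and
-- a subset of the ring is a Subset order (a Boolean vector).  So subsets, and
-- in particular ideals, are detachable, which is no restriction classically.
-- Quantifying over arbitrary predicates instead would make "every ideal is
-- principal" imply excluded middle.
record FiniteRing c ℓ : Set (lsuc (c ⊔ ℓ)) where
  field
    commutativeRing : CommutativeRing c ℓ

  open CommutativeRing commutativeRing public

  field
    order       : ℕ
    enumeration : Inverse setoid (≡.setoid (Fin order))

  open RawMagmaDefinitions *-rawMagma public using (_∣_)
  open RawMonoidDefinitions +-rawMonoid public using (sum)
  open RawSemiringDefinitions (Semiring.rawSemiring semiring) public using () renaming (_^_ to _^ᴿ_)

  code : Carrier → Fin order
  code = Inverse.to enumeration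

  element : Fin order → Carrier
  element = Inverse.from enumeration

  infix 4 _∈ᴿ_ _≈?_

  _∈ᴿ_ : Carrier → Subset order → Set
  x ∈ᴿ A = code x ∈ A

  _≈?_ : Decidable₂ _≈_
  x ≈? y = map′ (λ eq → trans (sym (Inverse.strictlyInverseʳ enumeration x))
                          (Inverse.inverseʳ enumeration eq))
                (Inverse.to-cong enumeration)
                (code x Fin.≟ code y)

  -- { x | P x }; only used for predicates P that respect _≈_.
  comprehension : {P : Pred Carrier p} → Decidable P → Subset order
  comprehension P? = tabulate (does ∘ P? ∘ element)

  infixl 6 _⊕_

  _⊕_ : Subset order → Subset order → Subset order
  A ⊕ B = comprehension {P = λ x → ∃₂ λ i j → i ∈ A × j ∈ B × element i + element j ≈ x}
    λ x → Fin.any? λ i → Fin.any? λ j →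
      (i ∈? A) ×-dec (j ∈? B) ×-dec (element i + element j ≈? x)

  squares : Subset order → Subset order
  squares A = comprehension {P = λ x → ∃ λ i → i ∈ A × element i * element i ≈ x}
    λ x → Fin.any? λ i → (i ∈? A) ×-dec (element i * element i ≈? x)

  -- The set of all n-term sums of elements of B, not a set of multiples of n.
  _-fold_ : ℕ → Subset order → Subset order
  n -fold B =
    comprehension {P = λ x → ∃ λ (v : Vec (Fin order) n) →
                     (∀ k → lookup v k ∈ B) × sum (element ∘ lookup v) ≈ x}
      λ x → any-vec? n λ v →
        Fin.all? (λ k → lookup v k ∈? B) ×-dec (sum (element ∘ lookup v) ≈? x)

  record IsIdeal (I : Subset order) : Set c where
    field
      0-mem    : 0# ∈ᴿ I
      +-closed : ∀ {x y} → x ∈ᴿ I → y ∈ᴿ I → x + y ∈ᴿ I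
      *-closed : ∀ x {y} → y ∈ᴿ I → x * y ∈ᴿ I

  record IsMaximalIdeal (M : Subset order) : Set c where
    field
      isIdeal : IsIdeal M
      proper  : M ≢ ⊤
      maximal : ∀ I → IsIdeal I → M ⊆ I → I ≡ M ⊎ I ≡ ⊤

  _Generates_ : Carrier → Subset order → Set (c ⊔ ℓ)
  z Generates I = ∀ x → x ∈ᴿ I ⇔ z ∣ x

  IsLocal : Set c
  IsLocal = ∃! _≡_ IsMaximalIdeal

  IsPrincipal : Set (c ⊔ ℓ)
  IsPrincipal = ∀ I → IsIdeal I → ∃ λ z → z Generates I

  IsUniformizer : Carrier → Set (c ⊔ ℓ)
  IsUniformizer z = ∃ λ M → IsMaximalIdeal M × z Generates M

  IsNilpotencyIndex : Carrier → ℕ → Set ℓ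
  IsNilpotencyIndex z r =
    0 < r × z ^ᴿ r ≈ 0# × (∀ s → 0 < s → z ^ᴿ s ≈ 0# → r ≤ s)

  -- The quotient by (z) has q elements: Carrier with congruence modulo z as its
  -- equality is in bijection with Fin q.
  QuotientHasSize : Carrier → ℕ → Set (c ⊔ ℓ)
  QuotientHasSize z q = ∃ λ (f : Carrier → Fin q) →
    Congruent _≡ᶻ_ _≡_ f × Bijective _≡ᶻ_ _≡_ f
    where
    _≡ᶻ_ : Carrier → Carrier → Set (c ⊔ ℓ)
    x ≡ᶻ y = z ∣ (x - y)

record FiniteValuationRing c ℓ : Set (lsuc (c ⊔ ℓ)) where
  field
    finiteRing : FiniteRing c ℓ

  open FiniteRing finiteRing public

  field
    isLocal     : IsLocal
    isPrincipal : IsPrincipal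

IsOddPrimePower : ℕ → Set
IsOddPrimePower q = ∃₂ λ p k → Prime p × p ≢ 2 × 0 < k × q ≡ p ^ k

fromℕ : ℕ → ℚ
fromℕ n = + n / 1

open RawSemiringDefinitions +-*-rawSemiring public using () renaming (_^_ to _^ℚ_)

{-# OPTIONS --safe #-}
module Submission where

-- For A, X ⊆ R let f(u, v) count the pairs (b, x) ∈ A × X whose parabola
-- v = (u − b)² + x passes through (u, v), and let L = |A||X|.  Two parabolas with
-- b − b′ ∉ (z) meet at most once, because 2(b − b′) is not a zero divisor; hence
-- Σ f² ≤ L² + q^(2r−1) L, whereas Σ f = q^r L.  As (a + b, a² + x) lies on the
-- parabola of (b, x), the sum of f over (A + A) × (A² + X) is at least |A| L.
-- Cauchy–Schwarz for the deviation of f from its mean therefore gives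
--   q^r |A| ≤ 2 |A + A||A² + X|   or   |A|³|X| ≤ 4 q^(2r−1) |A + A||A² + X|.
-- Now take X = kA² and induct on k, starting from |A| ≤ 4|A²|: at least half of A
-- lies outside (z), where squaring is at most two-to-one.  The outcome is the inequality with C = 1/4.

open import Defs
open import Algebra.Bundles using (CommutativeRing; RawRing)
open import Algebra.Morphism.Structures using (IsRingMonomorphism)
import Algebra.Morphism.RingMonomorphism as RingMonomorphism
import Algebra.Properties.Ring as RingProperties
import Algebra.Properties.Semiring.Divisibility as SemiringDivisibility
open import Algebra.Structures using (IsCommutativeRing)
open import Data.Fin.Base using (Fin; zero; suc)
open import Data.Fin.Permutation using (Permutation; permutation)
import Data.Fin.Properties as Fin
open import Data.Fin.Subset using (Subset; _∈_; _∉_; _⊆_; ∣_∣; Nonempty; inside; outside)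
open import Data.Fin.Subset.Properties using (_∈?_; drop-there; ∈⊤; nonempty?; Empty-unique; ∣⊥∣≡0)
open import Data.Integer.Base as ℤ using (+_; +≤+)
import Data.Integer.Properties as ℤ
open import Data.Nat.Base as ℕ using (ℕ; zero; suc; NonZero; _+_; _*_; _^_; _∸_; _⊔_; _≤_; _<_; z≤n; s≤s)
open import Data.Nat.Divisibility using (m%n≡0⇒n∣m)
import Data.Nat.DivMod as ℕ
open import Data.Nat.Primality using (Prime; prime⇒irreducible)
open import Data.Nat.Properties as ℕ using (m^n≢0; module ≤-Reasoning)
open import Data.Nat.Tactic.RingSolver using (solve-∀)
open import Data.Product.Base using (∃; ∃₂; _×_; _,_; proj₁; proj₂)
open import Data.Rational.Base as ℚ using (ℚ; 0ℚ; _/_; toℚᵘ)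
import Data.Rational.Properties as ℚ
open import Data.Rational.Unnormalised.Base as ℚᵘ using (mkℚᵘ; *≤*; *≡*)
import Data.Rational.Unnormalised.Properties as ℚᵘ
open import Data.Sum.Base as Sum using (_⊎_; inj₁; inj₂)
open import Data.Vec.Base using (Vec; []; _∷_; lookup; there)
open import Data.Vec.Properties using (lookup∘tabulate; []=⇒lookup; lookup⇒[]=)
open import Function.Base using (_∘_)
open import Function.Bundles using (Inverse; Equivalence)
open import Function.Definitions using (Injective)
open import Level using (Level; 0ℓ)
open import Relation.Binary.PropositionalEquality
  using (_≡_; _≢_; refl; sym; trans; cong; cong₂; subst; subst₂; module ≡-Reasoning)
open import Relation.Nullary using (Dec; yes; no; does; ¬_; contradiction)
open import Relation.Nullary.Decidable using (¬?; dec-true; _×-dec_)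
open import Relation.Unary using (Pred; Decidable)

open import Algebra.Properties.Semiring.Sum ℕ.+-*-semiring

-- The constants 2 and 4 in the dichotomy come from one comparison. With `P = |A + A||A² + X|` and
-- `N = q^r`, the mean of f is `L/N`, so a typical set of `P` points carries weight `PL/N`. If
-- `2P ≤ N|A|`, this is at most half of the `|A|L` incidences actually present, and the excess over
-- the mean is at least `|A|L/2`. Cauchy-Schwarz with variance `Σ f² − L² ≤ N|(z)|L` then gives
-- `|A|²L ≤ 4N|(z)|P`. All of this is carried out in ℕ, so the deviation is never formed: it appears
-- as a completed square with the negative terms moved across. The obstacle compared with a field is
-- the pairs with `b − b′ ∈ (z)`, whose parabolas may overlap heavily. They get only the trivial
-- bound, but each `b` has at most `|(z)|` such partners; this is the source of `N|(z)| = q^(2r−1)`.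
-- The start of the induction loses a factor 4 and so does each of the `n − 1` steps. The total loss
-- `4^n` becomes 4 after an n-th root, so that C does not even depend on n.

private
  variable
    p : Level
    P Q : Set p
    m n : ℕ

-- Indicators and finite sums over `Fin n`.

⟦_⟧ : Dec P → ℕ
⟦ yes _ ⟧ = 1
⟦ no  _ ⟧ = 0

⟦⟧≤1 : (d : Dec P) → ⟦ d ⟧ ≤ 1
⟦⟧≤1 (yes _) = ℕ.≤-refl
⟦⟧≤1 (no _)  = z≤n

⟦⟧-true : (d : Dec P) → P → ⟦ d ⟧ ≡ 1
⟦⟧-true (yes _) _ = refl
⟦⟧-true (no ¬p) p = contradiction p ¬p

⟦⟧-false : (d : Dec P) → ¬ P → ⟦ d ⟧ ≡ 0
⟦⟧-false (yes p) ¬p = contradiction p ¬p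
⟦⟧-false (no _)  _  = refl

⟦⟧-idem : (d : Dec P) → ⟦ d ⟧ * ⟦ d ⟧ ≡ ⟦ d ⟧
⟦⟧-idem (yes _) = refl
⟦⟧-idem (no _)  = refl

⟦⟧-cong : (d : Dec P) (e : Dec Q) → (P → Q) → (Q → P) → ⟦ d ⟧ ≡ ⟦ e ⟧
⟦⟧-cong (yes p) e f g = sym (⟦⟧-true e (f p))
⟦⟧-cong (no ¬p) e f g = sym (⟦⟧-false e (¬p ∘ g))

⟦⟧*-≤ : (d : Dec P) {a b : ℕ} → (P → a ≤ b) → ⟦ d ⟧ * a ≤ b
⟦⟧*-≤ (yes p) {a} h = subst (_≤ _) (sym (ℕ.*-identityˡ a)) (h p)
⟦⟧*-≤ (no _)      h = z≤n

⟦⟧-≤ : (d : Dec P) {b : ℕ} → (P → 1 ≤ b) → ⟦ d ⟧ ≤ b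
⟦⟧-≤ (yes p) h = h p
⟦⟧-≤ (no _)  h = z≤n

sum-mono : {f g : Fin n → ℕ} → (∀ i → f i ≤ g i) → sum f ≤ sum g
sum-mono {zero}  f≤g = z≤n
sum-mono {suc n} f≤g = ℕ.+-mono-≤ (f≤g zero) (sum-mono (f≤g ∘ suc))

sum-const : ∀ n k → ∑[ i < n ] k ≡ n * k
sum-const zero    k = refl
sum-const (suc n) k = cong (λ s → k + s) (sum-const n k)

sum-sift : (F : Fin n → ℕ) (i : Fin n) → ∑[ j < n ] (⟦ i Fin.≟ j ⟧ * F j) ≡ F i
sum-sift {suc n} F zero = begin
  1 * F zero + ∑[ j < n ] 0  ≡⟨ cong₂ _+_ (ℕ.*-identityˡ _) (sum-replicate-zero n) ⟩
  F zero + 0                 ≡⟨ ℕ.+-identityʳ _ ⟩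
  F zero                     ∎
  where open ≡-Reasoning
sum-sift {suc n} F (suc i) = trans
  (sum-cong-≗ λ j → cong (_* F (suc j)) (⟦⟧-cong (suc i Fin.≟ suc j) (i Fin.≟ j) Fin.suc-injective (cong suc)))
  (sum-sift (F ∘ suc) i)

sum-point : (i : Fin n) → ∑[ j < n ] ⟦ i Fin.≟ j ⟧ ≡ 1
sum-point i = trans (sum-cong-≗ λ j → sym (ℕ.*-identityʳ ⟦ i Fin.≟ j ⟧)) (sum-sift (λ _ → 1) i)

-- Writing `F (φ i)` as a sum over j of `⟦ φ i ≟ j ⟧ * F j` and exchanging the sums leaves each
-- `F j` weighted by its fibre. It serves with `k = 1` for injections and with `k = 2` for squaring
-- outside the maximal ideal.
sum-fibres : (φ : Fin m → Fin n) (g : Fin m → ℕ) (F : Fin n → ℕ) (k : ℕ) →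
             (∀ j → ∑[ i < m ] (g i * ⟦ φ i Fin.≟ j ⟧) ≤ k) →
             ∑[ i < m ] (g i * F (φ i)) ≤ k * sum F
sum-fibres {m} {n} φ g F k fibre≤k = begin
  ∑[ i < m ] (g i * F (φ i))
    ≡⟨ sum-cong-≗ (λ i → cong (g i *_) (sum-sift F (φ i))) ⟨
  ∑[ i < m ] (g i * ∑[ j < n ] (⟦ φ i Fin.≟ j ⟧ * F j))
    ≡⟨ sum-cong-≗ (λ i → *-distribˡ-sum {n} (g i) _) ⟩
  ∑[ i < m ] ∑[ j < n ] (g i * (⟦ φ i Fin.≟ j ⟧ * F j))
    ≡⟨ ∑-comm (λ i j → g i * (⟦ φ i Fin.≟ j ⟧ * F j)) ⟩
  ∑[ j < n ] ∑[ i < m ] (g i * (⟦ φ i Fin.≟ j ⟧ * F j))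
    ≡⟨ sum-cong-≗ (λ j → sum-cong-≗ λ i → sym (ℕ.*-assoc (g i) _ (F j))) ⟩
  ∑[ j < n ] ∑[ i < m ] (g i * ⟦ φ i Fin.≟ j ⟧ * F j)
    ≡⟨ sum-cong-≗ (λ j → *-distribʳ-sum {m} (F j) _) ⟨
  ∑[ j < n ] (∑[ i < m ] (g i * ⟦ φ i Fin.≟ j ⟧) * F j)
    ≤⟨ sum-mono (λ j → ℕ.*-monoˡ-≤ (F j) (fibre≤k j)) ⟩
  ∑[ j < n ] (k * F j)
    ≡⟨ *-distribˡ-sum k F ⟨
  k * sum F ∎
  where open ≤-Reasoning

sum-injective : (φ : Fin m → Fin n) → Injective _≡_ _≡_ φ → (F : Fin n → ℕ) →
                sum (F ∘ φ) ≤ sum F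
sum-injective {m} {n} φ inj F = begin
  sum (F ∘ φ)                  ≡⟨ sum-cong-≗ (λ i → ℕ.*-identityˡ (F (φ i))) ⟨
  ∑[ i < m ] (1 * F (φ i))     ≤⟨ sum-fibres φ (λ _ → 1) F 1 fibre≤1 ⟩
  1 * sum F                    ≡⟨ ℕ.*-identityˡ _ ⟩
  sum F                        ∎
  where
  open ≤-Reasoning
  fibre≤1 : ∀ j → ∑[ i < m ] (1 * ⟦ φ i Fin.≟ j ⟧) ≤ 1
  fibre≤1 j with Fin.any? (λ i → φ i Fin.≟ j)
  ... | yes (i₀ , φi₀≡j) = begin
    ∑[ i < m ] (1 * ⟦ φ i Fin.≟ j ⟧)  ≤⟨ sum-mono (λ i → ℕ.≤-trans (ℕ.≤-reflexive (ℕ.*-identityˡ _))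
                                          (⟦⟧-≤ (φ i Fin.≟ j) λ φi≡j → ℕ.≤-reflexive
                                            (sym (⟦⟧-true (i₀ Fin.≟ i) (inj (trans φi₀≡j (sym φi≡j))))))) ⟩
    ∑[ i < m ] ⟦ i₀ Fin.≟ i ⟧         ≡⟨ sum-point i₀ ⟩
    1                                 ∎
  ... | no ∄i = begin
    ∑[ i < m ] (1 * ⟦ φ i Fin.≟ j ⟧)  ≡⟨ sum-cong-≗ (λ i → cong (1 *_) (⟦⟧-false (φ i Fin.≟ j) (∄i ∘ (i ,_)))) ⟩
    ∑[ i < m ] 0                      ≡⟨ sum-replicate-zero m ⟩
    0                                 ≤⟨ z≤n ⟩
    1                                 ∎

χ : Subset n → Fin n → ℕ
χ A i = ⟦ i ∈? A ⟧

χ-suc : ∀ s (A : Subset n) i → χ (s ∷ A) (suc i) ≡ χ A i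
χ-suc s A i = ⟦⟧-cong (suc i ∈? s ∷ A) (i ∈? A) drop-there there

sum-χ : (A : Subset n) → sum (χ A) ≡ ∣ A ∣
sum-χ []            = refl
sum-χ (inside ∷ A)  = cong suc (trans (sum-cong-≗ (χ-suc inside A)) (sum-χ A))
sum-χ (outside ∷ A) = trans (sum-cong-≗ (χ-suc outside A)) (sum-χ A)

sum-swap : (a : Fin m → ℕ) (k : Fin m → Fin n → ℕ) →
           ∑[ j < n ] ∑[ i < m ] (a i * k i j) ≡ ∑[ i < m ] (a i * sum (k i))
sum-swap {m} {n} a k = trans (∑-comm (λ j i → a i * k i j))
  (sum-cong-≗ λ i → sym (*-distribˡ-sum {n} (a i) (k i)))

sum-+-* : ∀ c d (f g : Fin n → ℕ) →
          ∑[ i < n ] (c * f i + d * g i) ≡ c * sum f + d * sum g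
sum-+-* {n} c d f g = trans (∑-distrib-+ (λ i → c * f i) (λ i → d * g i))
  (cong₂ _+_ (sym (*-distribˡ-sum {n} c f)) (sym (*-distribˡ-sum {n} d g)))

-- The shape is that of `square-completion`, and it reproduces itself: only the constant `d` is
-- multiplied by n. So it can be applied once for each coordinate of the plane.
sum-≤-linear : ∀ a b c d e (f g h k : Fin n → ℕ) →
               (∀ i → a * f i + b * g i ≤ c * h i + (d + e * k i)) →
               a * sum f + b * sum g ≤ c * sum h + (n * d + e * sum k)
sum-≤-linear {n} a b c d e f g h k le = begin
  a * sum f + b * sum g                                ≡⟨ sum-+-* a b f g ⟨
  ∑[ i < n ] (a * f i + b * g i)                       ≤⟨ sum-mono le ⟩
  ∑[ i < n ] (c * h i + (d + e * k i))                 ≡⟨ ∑-distrib-+ (λ i → c * h i) (λ i → d + e * k i) ⟩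
  ∑[ i < n ] (c * h i) + ∑[ i < n ] (d + e * k i)
    ≡⟨ cong₂ _+_ (sym (*-distribˡ-sum {n} c h)) (trans (∑-distrib-+ (λ _ → d) (λ i → e * k i))
                   (cong₂ _+_ (sum-const n d) (sym (*-distribˡ-sum {n} e k)))) ⟩
  c * sum h + (n * d + e * sum k)                      ∎
  where open ≤-Reasoning

2ab≤a²+b² : ∀ a b → 2 * (a * b) ≤ a * a + b * b
2ab≤a²+b² a b = either (ℕ.≤-total a b)
  where
  expand : ∀ a k → 2 * (a * (a + k)) + k * k ≡ a * a + (a + k) * (a + k)
  expand = solve-∀
  ordered : ∀ a b → a ≤ b → 2 * (a * b) ≤ a * a + b * b
  ordered a b a≤b with k , refl ← ℕ.m≤n⇒∃[o]m+o≡n a≤b = ℕ.m+n≤o⇒m≤o _ (ℕ.≤-reflexive (expand a k))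
  either : a ≤ b ⊎ b ≤ a → 2 * (a * b) ≤ a * a + b * b
  either (inj₁ a≤b) = ordered a b a≤b
  either (inj₂ b≤a) = subst₂ _≤_ (cong (2 *_) (ℕ.*-comm b a)) (ℕ.+-comm (b * b) (a * a)) (ordered b a b≤a)

-- Odd numbers.

Odd : ℕ → Set
Odd n = ∃ λ h → n ≡ suc (h + h)

odd-* : ∀ {m n} → Odd m → Odd n → Odd (m * n)
odd-* (h , refl) (k , refl) = (h + k + (h * k + h * k)) , expand h k
  where
  expand : ∀ h k → suc (h + h) * suc (k + k) ≡ suc (h + k + (h * k + h * k) + (h + k + (h * k + h * k)))
  expand = solve-∀

odd-^ : ∀ {m} n → Odd m → Odd (m ^ n)
odd-^ zero    _     = 0 , refl
odd-^ (suc n) odd-m = odd-* odd-m (odd-^ n odd-m)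

odd-prime : ∀ {p} → Prime p → p ≢ 2 → Odd p
odd-prime {p} p-prime p≢2 with p ℕ.% 2 in p%2≡ | ℕ.m%n<n p 2 | ℕ.m≡m%n+[m/n]*n p 2
... | 0 | _ | _ with prime⇒irreducible p-prime (m%n≡0⇒n∣m p 2 p%2≡)
...   | inj₂ 2≡p = contradiction (sym 2≡p) p≢2
odd-prime {p} p-prime p≢2 | 1 | _ | p≡ = p ℕ./ 2 , trans p≡ (cong suc (twice (p ℕ./ 2)))
  where
  twice : ∀ n → n * 2 ≡ n + n
  twice = solve-∀
odd-prime {p} p-prime p≢2 | suc (suc _) | s≤s (s≤s ()) | _

odd-prime-power : ∀ {q} → IsOddPrimePower q → Odd q
odd-prime-power (p , k , p-prime , p≢2 , _ , refl) = odd-^ k (odd-prime p-prime p≢2)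

-- This is 0 ≤ (w(Nf − L) − sτ)², with every term moved to the side where it is
-- positive and τ² = τ.
square-completion : ∀ w s N L f τ → τ * τ ≡ τ →
  2 * (w * N * (w * L)) * f + 2 * (w * N * s) * (f * τ) ≤
  w * N * (w * N) * (f * f) + (w * L * (w * L) + (2 * (w * L * s) + s * s) * τ)
square-completion w s N L f τ τ²≡τ = begin
  2 * (w * N * (w * L)) * f + 2 * (w * N * s) * (f * τ)  ≡⟨ lhs w s N L f τ ⟩
  2 * (w * N * f * (w * L + s * τ))                      ≤⟨ 2ab≤a²+b² (w * N * f) (w * L + s * τ) ⟩
  w * N * f * (w * N * f) + (w * L + s * τ) * (w * L + s * τ)
    ≡⟨ rhs w s N L f τ ⟩
  w * N * (w * N) * (f * f) + (w * L * (w * L) + (2 * (w * L * s) * τ + s * s * (τ * τ)))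
    ≡⟨ cong (λ t → w * N * (w * N) * (f * f) + (w * L * (w * L) + (2 * (w * L * s) * τ + s * s * t))) τ²≡τ ⟩
  w * N * (w * N) * (f * f) + (w * L * (w * L) + (2 * (w * L * s) * τ + s * s * τ))
    ≡⟨ cong (λ t → w * N * (w * N) * (f * f) + (w * L * (w * L) + t)) (ℕ.*-distribʳ-+ τ (2 * (w * L * s)) (s * s)) ⟨
  w * N * (w * N) * (f * f) + (w * L * (w * L) + (2 * (w * L * s) + s * s) * τ) ∎
  where
  open ≤-Reasoning
  lhs : ∀ w s N L f τ → 2 * (w * N * (w * L)) * f + 2 * (w * N * s) * (f * τ) ≡
                        2 * (w * N * f * (w * L + s * τ))
  lhs = solve-∀
  rhs : ∀ w s N L f τ → w * N * f * (w * N * f) + (w * L + s * τ) * (w * L + s * τ) ≡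
    w * N * (w * N) * (f * f) + (w * L * (w * L) + (2 * (w * L * s) * τ + s * s * (τ * τ)))
  rhs = solve-∀

-- Summed over all points, the square completion bounds w N³ m L + s² P/w from below
-- by 2 s (N α L − P L); the optimal ratio s/w = (N α − P) L/P is replaced by
-- N α L/(2P), which is at least half of it.
square-completion-optimised : ∀ N m α L P → .{{NonZero N}} → .{{NonZero L}} → .{{NonZero P}} →
  (let w = 2 * P; s = N * (α * L) in
   2 * (w * N * (w * L)) * (N * L) + 2 * (w * N * s) * (α * L) ≤
   w * N * (w * N) * (L * L + N * m * L) + (N * (N * (w * L * (w * L))) + (2 * (w * L * s) + s * s) * P)) →
  N * α ≤ 2 * P ⊎ α * α * L ≤ 4 * (N * m) * P
square-completion-optimised N m α L P le with ℕ.≤-total (N * α) (2 * P)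
... | inj₁ Nα≤2P = inj₁ Nα≤2P
-- Here `2P ≤ Nα` turns the cross term `2P · 2αL` into `2Nα²L`. Three of the four copies of `Nα²L`
-- on the left are then absorbed, and one survives to be compared with `4PN²m`.
... | inj₂ 2P≤Nα = inj₂ (ℕ.*-cancelˡ-≤ N (ℕ.+-cancelʳ-≤ (3 * (N * (α * α * L))) _ _ (begin
  N * (α * α * L) + 3 * (N * (α * α * L))      ≡⟨ four N α L ⟩
  4 * (N * (α * α * L))                        ≤⟨ reduced ⟩
  4 * (P * N * N * m) + 2 * P * (2 * (α * L)) + N * (α * α * L)
    ≤⟨ ℕ.+-monoˡ-≤ (N * (α * α * L)) (ℕ.+-monoʳ-≤ (4 * (P * N * N * m)) (ℕ.*-monoˡ-≤ (2 * (α * L)) 2P≤Nα)) ⟩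
  4 * (P * N * N * m) + N * α * (2 * (α * L)) + N * (α * α * L)
    ≡⟨ collect N m α L P ⟩
  N * (4 * (N * m) * P) + 3 * (N * (α * α * L)) ∎)))
  where
  open ≤-Reasoning
  four : ∀ N α L → N * (α * α * L) + 3 * (N * (α * α * L)) ≡ 4 * (N * (α * α * L))
  four = solve-∀
  collect : ∀ N m α L P → 4 * (P * N * N * m) + N * α * (2 * (α * L)) + N * (α * α * L) ≡
                          N * (4 * (N * m) * P) + 3 * (N * (α * α * L))
  collect = solve-∀
  lhs : ∀ N α L P → 2 * (2 * P * N * (2 * P * L)) * (N * L) + 2 * (2 * P * N * (N * (α * L))) * (α * L) ≡
                    8 * (P * N * L) * (P * N * L) + P * N * L * (4 * (N * (α * α * L)))
  lhs = solve-∀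
  rhs : ∀ N m α L P →
    2 * P * N * (2 * P * N) * (L * L + N * m * L) +
      (N * (N * (2 * P * L * (2 * P * L))) + (2 * (2 * P * L * (N * (α * L))) + N * (α * L) * (N * (α * L))) * P) ≡
    8 * (P * N * L) * (P * N * L) + P * N * L * (4 * (P * N * N * m) + 2 * P * (2 * (α * L)) + N * (α * α * L))
  rhs = solve-∀
  -- The main terms `8(PNL)²` agree on both sides: this is the cancellation of the squared mean in
  -- the variance. What remains has the common factor `PNL`.
  reduced : 4 * (N * (α * α * L)) ≤ 4 * (P * N * N * m) + 2 * P * (2 * (α * L)) + N * (α * α * L)
  reduced = ℕ.*-cancelˡ-≤ (P * N * L) {{ℕ.m*n≢0 (P * N) L {{ℕ.m*n≢0 P N}}}}
    (ℕ.+-cancelˡ-≤ (8 * (P * N * L) * (P * N * L)) _ _ (subst₂ _≤_ (lhs N α L P) (rhs N m α L P) le))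

-- Parabolas over a finite ring

module FiniteCounting
  {N : ℕ} {plus times : Fin N → Fin N → Fin N} {minus : Fin N → Fin N} {0ᴿ 1ᴿ : Fin N}
  (isCommutativeRing : IsCommutativeRing _≡_ plus times minus 0ᴿ 1ᴿ)
  where

  ring : CommutativeRing 0ℓ 0ℓ
  ring = record { isCommutativeRing = isCommutativeRing }

  open CommutativeRing ring using ()
    renaming ( _+_ to infixl 6 _⊞_; _-_ to infixl 6 _⊟_; _*_ to infixl 7 _⊠_
             ; -_ to infix 8 ⊖_; 0# to 𝟘; 1# to 𝟙)
  module 𝓡 = CommutativeRing ring
  open RingProperties 𝓡.ring using
    ( +-identityʳ-unique; +-inverseˡ-unique; +-cancelˡ; +-cancelʳ; x∙y⁻¹≈ε⇒x≈y
    ; -‿distribˡ-*; -‿distribʳ-*; -‿involutive; -‿+-comm)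

  open import Algebra.Solver.Ring.NaturalCoefficients.Default 𝓡.commutativeSemiring
    using (solve; _:+_; _:*_; _:=_)

  sq : Fin N → Fin N
  sq x = x ⊠ x

  x⊞y⊟y≡x : ∀ x y → x ⊞ y ⊟ y ≡ x
  x⊞y⊟y≡x x y = trans (𝓡.+-assoc x y (⊖ y)) (trans (cong (x ⊞_) (𝓡.-‿inverseʳ y)) (𝓡.+-identityʳ x))

  x⊟y⊞y≡x : ∀ x y → x ⊟ y ⊞ y ≡ x
  x⊟y⊞y≡x x y = trans (𝓡.+-assoc x (⊖ y) y) (trans (cong (x ⊞_) (𝓡.-‿inverseˡ y)) (𝓡.+-identityʳ x))

  translation : Fin N → Permutation N N
  translation c = permutation (_⊞ c) (_⊟ c) (λ x → x⊟y⊞y≡x x c) (λ x → x⊞y⊟y≡x x c)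

  sum-translate : (F : Fin N → ℕ) (c : Fin N) → sum F ≡ ∑[ i < N ] F (i ⊞ c)
  sum-translate F c = ∑-permute F (translation c)

  -- Translation is a permutation of the ring. With a fixed element of A, or its square, as shift,
  -- this yields both `|A| ≤ |A + A|` and the growth of the sets `kA²` with k.
  translate⊆⇒≤ : ∀ {X Y : Subset N} c → (∀ {x} → x ∈ X → x ⊞ c ∈ Y) → ∣ X ∣ ≤ ∣ Y ∣
  translate⊆⇒≤ {X} {Y} c X+c⊆Y = begin
    ∣ X ∣                     ≡⟨ sum-χ X ⟨
    sum (χ X)                 ≤⟨ sum-mono (λ x → ⟦⟧-≤ (x ∈? X) λ x∈X →
                                   ℕ.≤-reflexive (sym (⟦⟧-true (x ⊞ c ∈? Y) (X+c⊆Y x∈X)))) ⟩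
    ∑[ x < N ] χ Y (x ⊞ c)    ≡⟨ sum-translate (χ Y) c ⟨
    sum (χ Y)                 ≡⟨ sum-χ Y ⟩
    ∣ Y ∣                     ∎
    where open ≤-Reasoning

  ∑₂ : (Fin N → Fin N → ℕ) → ℕ
  ∑₂ F = ∑[ u < N ] ∑[ v < N ] F u v

  ∑₂-cong : ∀ {F G} → (∀ u v → F u v ≡ G u v) → ∑₂ F ≡ ∑₂ G
  ∑₂-cong F≗G = sum-cong-≗ λ u → sum-cong-≗ (F≗G u)

  ∑₂-mono : ∀ {F G} → (∀ u v → F u v ≤ G u v) → ∑₂ F ≤ ∑₂ G
  ∑₂-mono F≤G = sum-mono λ u → sum-mono (F≤G u)

  ∑₂-swap : (a : Fin N → ℕ) (k : Fin N → Fin N → Fin N → ℕ) →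
            ∑₂ (λ u v → ∑[ b < N ] (a b * k b u v)) ≡ ∑[ b < N ] (a b * ∑₂ (k b))
  ∑₂-swap a k = trans (sum-cong-≗ λ u → sum-swap a (λ b → k b u)) (sum-swap a (λ b u → sum (k b u)))

  -- Since `(a + d)² − a² = 2da + d²`, the value determines `2da`. Adding `a² + a′² + d²` to both
  -- sides makes the computation free of subtraction.
  difference-of-squares : ∀ {x a a′ d} →
    x ⊞ sq (a ⊞ d) ⊟ sq a ≡ x ⊞ sq (a′ ⊞ d) ⊟ sq a′ → d ⊠ a ⊞ d ⊠ a ≡ d ⊠ a′ ⊞ d ⊠ a′
  difference-of-squares {x} {a} {a′} {d} eq = +-cancelʳ (sq a ⊞ sq a′ ⊞ sq d) _ _ (begin
    d ⊠ a ⊞ d ⊠ a ⊞ (sq a ⊞ sq a′ ⊞ sq d)      ≡⟨ expand a a′ d ⟩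
    sq (a ⊞ d) ⊞ sq a′                         ≡⟨ +-cancelˡ x _ _ shifted ⟩
    sq (a′ ⊞ d) ⊞ sq a                         ≡⟨ expand′ a a′ d ⟨
    d ⊠ a′ ⊞ d ⊠ a′ ⊞ (sq a ⊞ sq a′ ⊞ sq d)    ∎)
    where
    open ≡-Reasoning
    expand : ∀ a a′ d → d ⊠ a ⊞ d ⊠ a ⊞ (sq a ⊞ sq a′ ⊞ sq d) ≡ sq (a ⊞ d) ⊞ sq a′
    expand = solve 3 (λ a a′ d → d :* a :+ d :* a :+ (a :* a :+ a′ :* a′ :+ d :* d) :=
                                 (a :+ d) :* (a :+ d) :+ a′ :* a′) refl
    expand′ : ∀ a a′ d → d ⊠ a′ ⊞ d ⊠ a′ ⊞ (sq a ⊞ sq a′ ⊞ sq d) ≡ sq (a′ ⊞ d) ⊞ sq a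
    expand′ = solve 3 (λ a a′ d → d :* a′ :+ d :* a′ :+ (a :* a :+ a′ :* a′ :+ d :* d) :=
                                  (a′ :+ d) :* (a′ :+ d) :+ a :* a) refl
    shifted : x ⊞ (sq (a ⊞ d) ⊞ sq a′) ≡ x ⊞ (sq (a′ ⊞ d) ⊞ sq a)
    shifted = begin
      x ⊞ (sq (a ⊞ d) ⊞ sq a′)        ≡⟨ 𝓡.+-assoc x _ _ ⟨
      x ⊞ sq (a ⊞ d) ⊞ sq a′          ≡⟨ cong (_⊞ sq a′) (x⊟y⊞y≡x (x ⊞ sq (a ⊞ d)) (sq a)) ⟨
      w ⊞ sq a ⊞ sq a′                ≡⟨ 𝓡.+-assoc w _ _ ⟩
      w ⊞ (sq a ⊞ sq a′)              ≡⟨ cong₂ _⊞_ eq (𝓡.+-comm (sq a) (sq a′)) ⟩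
      w′ ⊞ (sq a′ ⊞ sq a)             ≡⟨ 𝓡.+-assoc w′ _ _ ⟨
      w′ ⊞ sq a′ ⊞ sq a               ≡⟨ cong (_⊞ sq a) (x⊟y⊞y≡x (x ⊞ sq (a′ ⊞ d)) (sq a′)) ⟩
      x ⊞ sq (a′ ⊞ d) ⊞ sq a          ≡⟨ 𝓡.+-assoc x _ _ ⟩
      x ⊞ (sq (a′ ⊞ d) ⊞ sq a)        ∎
      where
      w w′ : Fin N
      w  = x ⊞ sq (a ⊞ d) ⊟ sq a
      w′ = x ⊞ sq (a′ ⊞ d) ⊟ sq a′

  module Parabolas (A X : Subset N) where

    -- Once `u`, `v` and `b` are given, `x` is forced to be `v − (u − b)²`, so a sum over `b` alone
    -- counts the pairs.
    f : Fin N → Fin N → ℕ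
    f u v = ∑[ b < N ] (χ A b * χ X (v ⊟ sq (u ⊟ b)))

    -- Opening one factor f turns a weighted sum over the plane into sums along parabolas. The
    -- total, the second moment and the incidences all start from it, with `h` equal to 1, to `f`
    -- and to the indicator of a product set.
    f-expand : (h : Fin N → Fin N → ℕ) →
      ∑₂ (λ u v → f u v * h u v) ≡
      ∑[ b < N ] (χ A b * ∑₂ (λ u v → χ X (v ⊟ sq (u ⊟ b)) * h u v))
    f-expand h = trans
      (∑₂-cong λ u v → trans (*-distribʳ-sum {N} (h u v) (λ b → χ A b * χ X (v ⊟ sq (u ⊟ b))))
        (sum-cong-≗ λ b → ℕ.*-assoc (χ A b) (χ X (v ⊟ sq (u ⊟ b))) (h u v)))
      (∑₂-swap (χ A) (λ b u v → χ X (v ⊟ sq (u ⊟ b)) * h u v))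

    substitute : (c : Fin N → Fin N) (h : Fin N → Fin N → ℕ) →
      ∑₂ (λ u v → χ X (v ⊟ c u) * h u v) ≡ ∑₂ (λ u x → χ X x * h u (x ⊞ c u))
    substitute c h = sum-cong-≗ λ u → trans
      (sum-translate (λ v → χ X (v ⊟ c u) * h u v) (c u))
      (sum-cong-≗ λ x → cong (λ t → χ X t * h u (x ⊞ c u)) (x⊞y⊟y≡x x (c u)))

    ∑₂-χ : ∑₂ (λ _ x → χ X x) ≡ N * ∣ X ∣
    ∑₂-χ = trans (sum-const N (sum (χ X))) (cong (N *_) (sum-χ X))

    first-moment : ∑₂ f ≡ N * (∣ A ∣ * ∣ X ∣)
    first-moment = begin
      ∑₂ f                                        ≡⟨ ∑₂-cong (λ u v → ℕ.*-identityʳ (f u v)) ⟨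
      ∑₂ (λ u v → f u v * 1)                      ≡⟨ f-expand (λ _ _ → 1) ⟩
      ∑[ b < N ] (χ A b * ∑₂ (λ u v → χ X (v ⊟ sq (u ⊟ b)) * 1))
        ≡⟨ sum-cong-≗ (λ b → cong (χ A b *_) (trans (substitute (λ u → sq (u ⊟ b)) (λ _ _ → 1))
             (trans (∑₂-cong λ u x → ℕ.*-identityʳ (χ X x)) ∑₂-χ))) ⟩
      ∑[ b < N ] (χ A b * (N * ∣ X ∣))            ≡⟨ *-distribʳ-sum {N} (N * ∣ X ∣) (χ A) ⟨
      sum (χ A) * (N * ∣ X ∣)                     ≡⟨ cong (_* (N * ∣ X ∣)) (sum-χ A) ⟩
      ∣ A ∣ * (N * ∣ X ∣)                         ≡⟨ rearrange (∣ A ∣) N (∣ X ∣) ⟩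
      N * (∣ A ∣ * ∣ X ∣)                         ∎
      where
      open ≡-Reasoning
      rearrange : ∀ a n x → a * (n * x) ≡ n * (a * x)
      rearrange = solve-∀

    incidences : (S V : Subset N) →
      (∀ {a b} → a ∈ A → b ∈ A → a ⊞ b ∈ S) → (∀ {a x} → a ∈ A → x ∈ X → x ⊞ sq a ∈ V) →
      ∣ A ∣ * (∣ A ∣ * ∣ X ∣) ≤ ∑₂ (λ u v → f u v * (χ S u * χ V v))
    incidences S V A+A⊆S X+A²⊆V = begin
      ∣ A ∣ * (∣ A ∣ * ∣ X ∣)
        ≡⟨ cong₂ _*_ (sym (sum-χ A)) (cong₂ _*_ (sym (sum-χ A)) (sym (sum-χ X))) ⟩
      sum (χ A) * (sum (χ A) * sum (χ X))
        ≡⟨ *-distribʳ-sum {N} (sum (χ A) * sum (χ X)) (χ A) ⟩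
      ∑[ b < N ] (χ A b * (sum (χ A) * sum (χ X)))
        ≡⟨ sum-cong-≗ (λ b → cong (χ A b *_) product) ⟩
      ∑[ b < N ] (χ A b * ∑₂ (λ a x → χ A a * χ X x))
        ≤⟨ sum-mono (λ b → ⟦⟧*-≤ (b ∈? A) λ b∈A → ℕ.≤-trans (bound b∈A)
             (ℕ.≤-reflexive (trans (sym (ℕ.*-identityˡ _)) (cong (_* inner b) (sym (⟦⟧-true (b ∈? A) b∈A)))))) ⟩
      ∑[ b < N ] (χ A b * inner b)
        ≡⟨ f-expand (λ u v → χ S u * χ V v) ⟨
      ∑₂ (λ u v → f u v * (χ S u * χ V v)) ∎
      where
      open ≤-Reasoning
      inner : Fin N → ℕ
      inner b = ∑₂ (λ u v → χ X (v ⊟ sq (u ⊟ b)) * (χ S u * χ V v))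
      product : sum (χ A) * sum (χ X) ≡ ∑₂ (λ a x → χ A a * χ X x)
      product = trans (*-distribʳ-sum {N} (sum (χ X)) (χ A))
        (sum-cong-≗ λ a → *-distribˡ-sum {N} (χ A a) (χ X))
      one≤ : ∀ {a b x} → a ∈ A → b ∈ A → x ∈ X → 1 ≤ χ X x * (χ S (a ⊞ b) * χ V (x ⊞ sq a))
      one≤ {a} {b} {x} a∈A b∈A x∈X = ℕ.≤-reflexive (sym (cong₂ _*_ (⟦⟧-true (x ∈? X) x∈X)
        (cong₂ _*_ (⟦⟧-true (a ⊞ b ∈? S) (A+A⊆S a∈A b∈A)) (⟦⟧-true (x ⊞ sq a ∈? V) (X+A²⊆V a∈A x∈X)))))
      -- For fixed `b`, the map `(a, x) ↦ (a + b, x + a²)` is a bijection of the plane, inverted by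
      -- `a = u − b` and `x = v − (u − b)²`. Hence different pairs are counted at different points.
      bound : ∀ {b} → b ∈ A → ∑₂ (λ a x → χ A a * χ X x) ≤ inner b
      bound {b} b∈A = begin
        ∑₂ (λ a x → χ A a * χ X x)
          ≤⟨ ∑₂-mono (λ a x → ⟦⟧*-≤ (a ∈? A) λ a∈A → ⟦⟧-≤ (x ∈? X) λ x∈X → one≤ a∈A b∈A x∈X) ⟩
        ∑₂ (λ a x → χ X x * (χ S (a ⊞ b) * χ V (x ⊞ sq a)))
          ≡⟨ ∑₂-cong (λ a x → cong (λ t → χ X x * (χ S (a ⊞ b) * χ V (x ⊞ sq t))) (x⊞y⊟y≡x a b)) ⟨
        ∑₂ (λ a x → χ X x * (χ S (a ⊞ b) * χ V (x ⊞ sq (a ⊞ b ⊟ b))))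
          ≡⟨ sum-translate (λ u → ∑[ x < N ] (χ X x * (χ S u * χ V (x ⊞ sq (u ⊟ b))))) b ⟨
        ∑₂ (λ u x → χ X x * (χ S u * χ V (x ⊞ sq (u ⊟ b))))
          ≡⟨ substitute (λ u → sq (u ⊟ b)) (λ u v → χ S u * χ V v) ⟨
        inner b ∎

  -- Two is invertible in a ring of odd order.

  module _ where
    open import Algebra.Properties.Monoid.Mult 𝓡.+-monoid using (×-homo-+) renaming (_×_ to _·_)
    import Algebra.Properties.CommutativeMonoid.Sum 𝓡.+-commutativeMonoid as ∑ᴿ

    -- Translation by `x` permutes the ring, so it preserves the sum of all elements; it also
    -- increases that sum by `N · x`.
    order-annihilates : ∀ x → N · x ≡ 𝟘
    order-annihilates x = +-identityʳ-unique (∑ᴿ.sum (λ y → y)) (N · x) (begin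
      ∑ᴿ.sum (λ y → y) ⊞ N · x
        ≡⟨ cong (∑ᴿ.sum (λ y → y) ⊞_) (∑ᴿ.sum-replicate N) ⟨
      ∑ᴿ.sum (λ y → y) ⊞ ∑ᴿ.sum {N} (λ _ → x)
        ≡⟨ ∑ᴿ.∑-distrib-+ (λ y → y) (λ _ → x) ⟨
      ∑ᴿ.sum (λ y → y ⊞ x)
        ≡⟨ ∑ᴿ.∑-permute (λ y → y) (translation x) ⟨
      ∑ᴿ.sum (λ y → y) ∎)
      where open ≡-Reasoning

    -- From `N = 1 + 2h` and `N · 1 = 0` it follows that `1 = −2h`, so `−h` is one half.
    odd-order⇒½ : Odd N → ∃ λ t → t ⊞ t ≡ 𝟙
    odd-order⇒½ (h , N≡1+2h) = ⊖ (h · 𝟙) , (begin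
      ⊖ (h · 𝟙) ⊟ h · 𝟙          ≡⟨ -‿+-comm (h · 𝟙) (h · 𝟙) ⟩
      ⊖ (h · 𝟙 ⊞ h · 𝟙)          ≡⟨ +-inverseˡ-unique 𝟙 (h · 𝟙 ⊞ h · 𝟙) vanishes ⟨
      𝟙                          ∎)
      where
      open ≡-Reasoning
      vanishes : 𝟙 ⊞ (h · 𝟙 ⊞ h · 𝟙) ≡ 𝟘
      vanishes = begin
        𝟙 ⊞ (h · 𝟙 ⊞ h · 𝟙)   ≡⟨ cong (𝟙 ⊞_) (×-homo-+ 𝟙 h h) ⟨
        suc (h + h) · 𝟙       ≡⟨ cong (_· 𝟙) N≡1+2h ⟨
        N · 𝟙                 ≡⟨ order-annihilates 𝟙 ⟩
        𝟘                     ∎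

  -- The counting estimate when elements outside `I` cancel and two is invertible.

  module LocalRing
    (I : Subset N) (cancel : ∀ {d x} → d ∉ I → d ⊠ x ≡ 𝟘 → x ≡ 𝟘)
    (t : Fin N) (t⊞t≡𝟙 : t ⊞ t ≡ 𝟙)
    where

    ½-double : ∀ x → t ⊠ (x ⊞ x) ≡ x
    ½-double x = begin
      t ⊠ (x ⊞ x)    ≡⟨ solve 2 (λ t x → t :* (x :+ x) := (t :+ t) :* x) refl t x ⟩
      (t ⊞ t) ⊠ x    ≡⟨ cong (_⊠ x) t⊞t≡𝟙 ⟩
      𝟙 ⊠ x          ≡⟨ 𝓡.*-identityˡ x ⟩
      x              ∎
      where open ≡-Reasoning

    double-injective : ∀ {x y} → x ⊞ x ≡ y ⊞ y → x ≡ y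
    double-injective {x} {y} eq = trans (sym (½-double x)) (trans (cong (t ⊠_) eq) (½-double y))

    ⊠-cancel : ∀ {d x y} → d ∉ I → d ⊠ x ≡ d ⊠ y → x ≡ y
    ⊠-cancel {d} {x} {y} d∉I eq = x∙y⁻¹≈ε⇒x≈y x y (cancel d∉I (begin
      d ⊠ (x ⊟ y)                ≡⟨ 𝓡.distribˡ d x (⊖ y) ⟩
      d ⊠ x ⊞ d ⊠ (⊖ y)          ≡⟨ cong₂ _⊞_ eq (sym (-‿distribʳ-* d y)) ⟩
      d ⊠ y ⊟ d ⊠ y              ≡⟨ 𝓡.-‿inverseʳ (d ⊠ y) ⟩
      𝟘                          ∎))
      where open ≡-Reasoning

    module _ (A X : Subset N) where
      open Parabolas A X

      -- Incidences between the family of parabolas with vertices above `b` and the one above `b′`.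
      -- Summed over `b` and `b′` in A, they give `Σ f²`.
      intersection : Fin N → Fin N → ℕ
      intersection b b′ = ∑₂ (λ u v → χ X (v ⊟ sq (u ⊟ b′)) * χ X (v ⊟ sq (u ⊟ b)))

      private
        split-difference : ∀ u b b′ → u ⊟ b′ ≡ u ⊟ b ⊞ (b ⊟ b′)
        split-difference u b b′ = begin
          u ⊟ b′                   ≡⟨ cong (_⊟ b′) (x⊟y⊞y≡x u b) ⟨
          u ⊟ b ⊞ b ⊟ b′           ≡⟨ 𝓡.+-assoc (u ⊟ b) b (⊖ b′) ⟩
          u ⊟ b ⊞ (b ⊟ b′)         ∎
          where open ≡-Reasoning

        -- Fix `x`. The parabola above `b` through the point at abscissa `u` of the parabola
        -- `(b′, x)` has parameter `φ x u`. This is affine in `u` with slope `2(b − b′)`, so no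
        -- parameter occurs twice and every pair from `X × X` meets at most once.
        intersection-∉ : ∀ b b′ → b ⊟ b′ ∉ I → intersection b b′ ≤ ∣ X ∣ * ∣ X ∣
        intersection-∉ b b′ d∉I = begin
          intersection b b′
            ≡⟨ substitute (λ u → sq (u ⊟ b′)) (λ u v → χ X (v ⊟ sq (u ⊟ b))) ⟩
          ∑₂ (λ u x → χ X x * χ X (φ x u))
            ≡⟨ sum-swap (χ X) (λ x u → χ X (φ x u)) ⟩
          ∑[ x < N ] (χ X x * sum (χ X ∘ φ x))
            ≤⟨ sum-mono (λ x → ℕ.*-monoʳ-≤ (χ X x) (sum-injective (φ x) (φ-injective x) (χ X))) ⟩
          ∑[ x < N ] (χ X x * sum (χ X))
            ≡⟨ *-distribʳ-sum {N} (sum (χ X)) (χ X) ⟨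
          sum (χ X) * sum (χ X)
            ≡⟨ cong₂ _*_ (sum-χ X) (sum-χ X) ⟩
          ∣ X ∣ * ∣ X ∣ ∎
          where
          open ≤-Reasoning
          φ : Fin N → Fin N → Fin N
          φ x u = x ⊞ sq (u ⊟ b′) ⊟ sq (u ⊟ b)
          φ-injective : ∀ x {u u′} → φ x u ≡ φ x u′ → u ≡ u′
          φ-injective x {u} {u′} eq = +-cancelʳ (⊖ b) u u′ (⊠-cancel d∉I (double-injective
            (difference-of-squares
              (subst₂ (λ s s′ → x ⊞ sq s ⊟ sq (u ⊟ b) ≡ x ⊞ sq s′ ⊟ sq (u′ ⊟ b))
                (split-difference u b b′) (split-difference u′ b b′) eq))))

        -- The abscissa `u` and the parameter `x ∈ X` of one parabola already determine the point.
        intersection≤ : ∀ b b′ → intersection b b′ ≤ N * ∣ X ∣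
        intersection≤ b b′ = begin
          intersection b b′
            ≡⟨ substitute (λ u → sq (u ⊟ b′)) (λ u v → χ X (v ⊟ sq (u ⊟ b))) ⟩
          ∑₂ (λ u x → χ X x * χ X (x ⊞ sq (u ⊟ b′) ⊟ sq (u ⊟ b)))
            ≤⟨ ∑₂-mono (λ u x → ℕ.≤-trans (ℕ.*-monoʳ-≤ (χ X x) (⟦⟧≤1 (_ ∈? X))) (ℕ.≤-reflexive (ℕ.*-identityʳ (χ X x)))) ⟩
          ∑₂ (λ _ x → χ X x)
            ≡⟨ ∑₂-χ ⟩
          N * ∣ X ∣ ∎
          where open ≤-Reasoning

        intersection-bound : ∀ b b′ → intersection b b′ ≤ ∣ X ∣ * ∣ X ∣ + χ I (b ⊟ b′) * (N * ∣ X ∣)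
        intersection-bound b b′ with b ⊟ b′ ∈? I
        ... | yes _   = ℕ.≤-trans (intersection≤ b b′) (ℕ.≤-trans
          (ℕ.≤-reflexive (sym (ℕ.*-identityˡ (N * ∣ X ∣)))) (ℕ.m≤n+m (1 * (N * ∣ X ∣)) (∣ X ∣ * ∣ X ∣)))
        ... | no  d∉I = ℕ.≤-trans (intersection-∉ b b′ d∉I) (ℕ.m≤m+n (∣ X ∣ * ∣ X ∣) 0)

      -- The map `b′ ↦ b − b′` is an involution, hence a permutation of the ring. The sum limits how
      -- often the trivial intersection bound is charged to a given `b`.
      sum-reflect : (b : Fin N) → ∑[ b′ < N ] χ I (b ⊟ b′) ≡ ∣ I ∣
      sum-reflect b = trans (sym (∑-permute (χ I) (permutation (b ⊟_) (b ⊟_) reflect reflect))) (sum-χ I)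
        where
        reflect : ∀ x → b ⊟ (b ⊟ x) ≡ x
        reflect x = begin
          b ⊟ (b ⊟ x)            ≡⟨ cong (b ⊞_) (-‿+-comm b (⊖ x)) ⟨
          b ⊞ (⊖ b ⊟ (⊖ x))      ≡⟨ cong (λ y → b ⊞ (⊖ b ⊞ y)) (-‿involutive x) ⟩
          b ⊞ (⊖ b ⊞ x)          ≡⟨ 𝓡.+-assoc b (⊖ b) x ⟨
          b ⊟ b ⊞ x              ≡⟨ cong (_⊞ x) (𝓡.-‿inverseʳ b) ⟩
          𝟘 ⊞ x                  ≡⟨ 𝓡.+-identityˡ x ⟩
          x                      ∎
          where open ≡-Reasoning

      second-moment : ∑₂ (λ u v → f u v * f u v) ≤
                      ∣ A ∣ * ∣ X ∣ * (∣ A ∣ * ∣ X ∣) + N * ∣ I ∣ * (∣ A ∣ * ∣ X ∣)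
      second-moment = begin
        ∑₂ (λ u v → f u v * f u v)
          ≡⟨ f-expand f ⟩
        ∑[ b < N ] (χ A b * ∑₂ (λ u v → χ X (v ⊟ sq (u ⊟ b)) * f u v))
          ≡⟨ sum-cong-≗ (λ b → cong (χ A b *_) (trans
               (∑₂-cong λ u v → ℕ.*-comm (χ X (v ⊟ sq (u ⊟ b))) (f u v))
               (f-expand (λ u v → χ X (v ⊟ sq (u ⊟ b)))))) ⟩
        ∑[ b < N ] (χ A b * ∑[ b′ < N ] (χ A b′ * intersection b b′))
          ≤⟨ sum-mono (λ b → ℕ.*-monoʳ-≤ (χ A b) (row b)) ⟩
        ∑[ b < N ] (χ A b * (∣ A ∣ * (∣ X ∣ * ∣ X ∣) + ∣ I ∣ * (N * ∣ X ∣)))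
          ≡⟨ *-distribʳ-sum {N} (∣ A ∣ * (∣ X ∣ * ∣ X ∣) + ∣ I ∣ * (N * ∣ X ∣)) (χ A) ⟨
        sum (χ A) * (∣ A ∣ * (∣ X ∣ * ∣ X ∣) + ∣ I ∣ * (N * ∣ X ∣))
          ≡⟨ cong (_* (∣ A ∣ * (∣ X ∣ * ∣ X ∣) + ∣ I ∣ * (N * ∣ X ∣))) (sum-χ A) ⟩
        ∣ A ∣ * (∣ A ∣ * (∣ X ∣ * ∣ X ∣) + ∣ I ∣ * (N * ∣ X ∣))
          ≡⟨ rearrange (∣ A ∣) (∣ X ∣) (∣ I ∣) N ⟩
        ∣ A ∣ * ∣ X ∣ * (∣ A ∣ * ∣ X ∣) + N * ∣ I ∣ * (∣ A ∣ * ∣ X ∣) ∎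
        where
        open ≤-Reasoning
        rearrange : ∀ a x m n → a * (a * (x * x) + m * (n * x)) ≡ a * x * (a * x) + n * m * (a * x)
        rearrange = solve-∀
        row : ∀ b → ∑[ b′ < N ] (χ A b′ * intersection b b′) ≤ ∣ A ∣ * (∣ X ∣ * ∣ X ∣) + ∣ I ∣ * (N * ∣ X ∣)
        row b = begin
          ∑[ b′ < N ] (χ A b′ * intersection b b′)
            -- The weight `χ A b′` stays on the first term only. In the second, `b′` is allowed to
            -- range over the whole ring, where the sum is exactly `|I|`.
            ≤⟨ sum-mono (λ b′ → ⟦⟧*-≤ (b′ ∈? A) (pointwise b′)) ⟩
          ∑[ b′ < N ] (χ A b′ * (∣ X ∣ * ∣ X ∣) + χ I (b ⊟ b′) * (N * ∣ X ∣))
            ≡⟨ ∑-distrib-+ (λ b′ → χ A b′ * (∣ X ∣ * ∣ X ∣)) (λ b′ → χ I (b ⊟ b′) * (N * ∣ X ∣)) ⟩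
          ∑[ b′ < N ] (χ A b′ * (∣ X ∣ * ∣ X ∣)) + ∑[ b′ < N ] (χ I (b ⊟ b′) * (N * ∣ X ∣))
            ≡⟨ cong₂ _+_ (*-distribʳ-sum {N} (∣ X ∣ * ∣ X ∣) (χ A)) (*-distribʳ-sum {N} (N * ∣ X ∣) (λ b′ → χ I (b ⊟ b′))) ⟨
          sum (χ A) * (∣ X ∣ * ∣ X ∣) + ∑[ b′ < N ] (χ I (b ⊟ b′)) * (N * ∣ X ∣)
            ≡⟨ cong₂ (λ y z → y * (∣ X ∣ * ∣ X ∣) + z * (N * ∣ X ∣)) (sum-χ A) (sum-reflect b) ⟩
          ∣ A ∣ * (∣ X ∣ * ∣ X ∣) + ∣ I ∣ * (N * ∣ X ∣) ∎
          where
          pointwise : ∀ b′ → b′ ∈ A → intersection b b′ ≤ χ A b′ * (∣ X ∣ * ∣ X ∣) + χ I (b ⊟ b′) * (N * ∣ X ∣)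
          pointwise b′ b′∈A = ℕ.≤-trans (intersection-bound b b′) (ℕ.+-monoˡ-≤ (χ I (b ⊟ b′) * (N * ∣ X ∣))
            (ℕ.≤-reflexive (trans (sym (ℕ.*-identityˡ (∣ X ∣ * ∣ X ∣))) (cong (_* (∣ X ∣ * ∣ X ∣)) (sym (⟦⟧-true (b′ ∈? A) b′∈A))))))

      sum-product : (S V : Subset N) → .{{NonZero N}} → .{{NonZero (∣ A ∣ * ∣ X ∣)}} → .{{NonZero (∣ S ∣ * ∣ V ∣)}} →
        (∀ {a b} → a ∈ A → b ∈ A → a ⊞ b ∈ S) → (∀ {a x} → a ∈ A → x ∈ X → x ⊞ sq a ∈ V) →
        N * ∣ A ∣ ≤ 2 * (∣ S ∣ * ∣ V ∣) ⊎
        ∣ A ∣ * ∣ A ∣ * (∣ A ∣ * ∣ X ∣) ≤ 4 * (N * ∣ I ∣) * (∣ S ∣ * ∣ V ∣)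
      sum-product S V A+A⊆S X+A²⊆V = square-completion-optimised N (∣ I ∣) (∣ A ∣) L SV (begin
        c₁ * (N * L) + c₂ * (∣ A ∣ * L)
          ≤⟨ ℕ.+-mono-≤ (ℕ.*-monoʳ-≤ c₁ (ℕ.≤-reflexive (sym first-moment)))
                        (ℕ.*-monoʳ-≤ c₂ (incidences S V A+A⊆S X+A²⊆V)) ⟩
        c₁ * ∑₂ f + c₂ * ∑₂ (λ u v → f u v * τ u v)
          ≤⟨ sum-≤-linear c₁ c₂ c₃ (N * (w * L * (w * L))) c₄ _ _ _ _ (λ u →
             sum-≤-linear c₁ c₂ c₃ (w * L * (w * L)) c₄ _ _ _ _ (λ v →
             square-completion w s N L (f u v) (τ u v) (τ-idem u v))) ⟩
        c₃ * ∑₂ (λ u v → f u v * f u v) +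
          (N * (N * (w * L * (w * L))) + c₄ * ∑₂ τ)
          ≤⟨ ℕ.+-monoˡ-≤ _ (ℕ.*-monoʳ-≤ c₃ second-moment) ⟩
        c₃ * (L * L + N * ∣ I ∣ * L) +
          (N * (N * (w * L * (w * L))) + c₄ * ∑₂ τ)
          ≡⟨ cong (λ y → c₃ * (L * L + N * ∣ I ∣ * L) + (N * (N * (w * L * (w * L))) + c₄ * y)) ∑₂-τ ⟩
        c₃ * (L * L + N * ∣ I ∣ * L) +
          (N * (N * (w * L * (w * L))) + c₄ * SV) ∎)
        where
        open ≤-Reasoning
        L SV w s c₁ c₂ c₃ c₄ : ℕ
        L = ∣ A ∣ * ∣ X ∣
        SV = ∣ S ∣ * ∣ V ∣
        w = 2 * SV
        s = N * (∣ A ∣ * L)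
        c₁ = 2 * (w * N * (w * L))
        c₂ = 2 * (w * N * s)
        c₃ = w * N * (w * N)
        c₄ = 2 * (w * L * s) + s * s
        τ : Fin N → Fin N → ℕ
        τ u v = χ S u * χ V v
        τ-idem : ∀ u v → τ u v * τ u v ≡ τ u v
        τ-idem u v = trans (interchange (χ S u) (χ V v)) (cong₂ _*_ (⟦⟧-idem (u ∈? S)) (⟦⟧-idem (v ∈? V)))
          where
          interchange : ∀ a b → a * b * (a * b) ≡ a * a * (b * b)
          interchange = solve-∀
        ∑₂-τ : ∑₂ τ ≡ SV
        ∑₂-τ = trans (sum-cong-≗ λ u → sym (*-distribˡ-sum {N} (χ S u) (χ V)))
          (trans (sym (*-distribʳ-sum {N} (sum (χ V)) (χ S))) (cong₂ _*_ (sum-χ S) (sum-χ V)))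

    -- Square roots outside an ideal.

    module _ (I-sum : ∀ {x y} → x ∈ I → y ∈ I → x ⊞ y ∈ I) (I-multiple : ∀ x {y} → y ∈ I → x ⊠ y ∈ I) where

      sq-⊖ : ∀ y → sq (⊖ y) ≡ sq y
      sq-⊖ y = begin
        ⊖ y ⊠ (⊖ y)        ≡⟨ -‿distribˡ-* y (⊖ y) ⟨
        ⊖ (y ⊠ (⊖ y))      ≡⟨ cong ⊖_ (-‿distribʳ-* y y) ⟨
        ⊖ (⊖ (y ⊠ y))      ≡⟨ -‿involutive (y ⊠ y) ⟩
        y ⊠ y              ∎
        where open ≡-Reasoning

      -- If `x² = y²`, then `(x + y)x = y² + xy = (x + y)y`, and `x + y` cancels.
      equal-roots : ∀ {x y} → x ⊞ y ∉ I → sq x ≡ sq y → x ≡ y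
      equal-roots {x} {y} s∉I x²≡y² = ⊠-cancel s∉I (begin
        (x ⊞ y) ⊠ x        ≡⟨ 𝓡.distribʳ x x y ⟩
        sq x ⊞ y ⊠ x       ≡⟨ cong₂ _⊞_ x²≡y² (𝓡.*-comm y x) ⟩
        sq y ⊞ x ⊠ y       ≡⟨ 𝓡.+-comm (sq y) (x ⊠ y) ⟩
        x ⊠ y ⊞ sq y       ≡⟨ 𝓡.distribʳ y x y ⟨
        (x ⊞ y) ⊠ y        ∎)
        where open ≡-Reasoning

      -- If `x + y` and `x − y` both lay in I, so would their sum `2x`, and then `x` after
      -- multiplication by one half. So one of them cancels.
      square-roots : ∀ {x y} → x ∉ I → sq x ≡ sq y → y ≡ x ⊎ y ≡ ⊖ x
      square-roots {x} {y} x∉I x²≡y² with x ⊞ y ∈? I | x ⊟ y ∈? I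
      ... | no s∉I  | _       = inj₁ (sym (equal-roots s∉I x²≡y²))
      ... | yes _   | no d∉I  = inj₂ (trans (sym (-‿involutive y))
        (cong ⊖_ (sym (equal-roots d∉I (trans x²≡y² (sym (sq-⊖ y)))))))
      ... | yes s∈I | yes d∈I = contradiction (subst (_∈ I) (½-double x)
        (I-multiple t (subst (_∈ I) sum≡double (I-sum s∈I d∈I)))) x∉I
        where
        open ≡-Reasoning
        sum≡double : x ⊞ y ⊞ (x ⊟ y) ≡ x ⊞ x
        sum≡double = begin
          x ⊞ y ⊞ (x ⊟ y)  ≡⟨ solve 3 (λ x y n → x :+ y :+ (x :+ n) := x :+ x :+ (y :+ n)) refl x y (⊖ y) ⟩
          x ⊞ x ⊞ (y ⊟ y)  ≡⟨ cong (x ⊞ x ⊞_) (𝓡.-‿inverseʳ y) ⟩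
          x ⊞ x ⊞ 𝟘        ≡⟨ 𝓡.+-identityʳ (x ⊞ x) ⟩
          x ⊞ x            ∎

      squares-bound : (A B : Subset N) → (∀ {a} → a ∈ A → sq a ∈ B) → ∣ A ∣ ≤ ∣ I ∣ + 2 * ∣ B ∣
      squares-bound A B A²⊆B = begin
        ∣ A ∣
          ≡⟨ sum-χ A ⟨
        sum (χ A)
          ≤⟨ sum-mono pointwise ⟩
        ∑[ a < N ] (χ I a + ⟦ ¬? (a ∈? I) ⟧ * χ B (sq a))
          ≡⟨ ∑-distrib-+ (χ I) (λ a → ⟦ ¬? (a ∈? I) ⟧ * χ B (sq a)) ⟩
        sum (χ I) + ∑[ a < N ] (⟦ ¬? (a ∈? I) ⟧ * χ B (sq a))
          ≤⟨ ℕ.+-mono-≤ (ℕ.≤-reflexive (sum-χ I)) (sum-fibres sq (λ a → ⟦ ¬? (a ∈? I) ⟧) (χ B) 2 fibre≤2) ⟩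
        ∣ I ∣ + 2 * sum (χ B)
          ≡⟨ cong (λ y → ∣ I ∣ + 2 * y) (sum-χ B) ⟩
        ∣ I ∣ + 2 * ∣ B ∣ ∎
        where
        open ≤-Reasoning
        pointwise : ∀ a → χ A a ≤ χ I a + ⟦ ¬? (a ∈? I) ⟧ * χ B (sq a)
        pointwise a with a ∈? I
        ... | yes _ = ℕ.≤-trans (⟦⟧≤1 (a ∈? A)) (s≤s z≤n)
        ... | no  _ = ⟦⟧-≤ (a ∈? A) λ a∈A → ℕ.≤-reflexive (sym (trans (ℕ.+-identityʳ _) (⟦⟧-true (sq a ∈? B) (A²⊆B a∈A))))
        fibre≤2 : ∀ j → ∑[ a < N ] (⟦ ¬? (a ∈? I) ⟧ * ⟦ sq a Fin.≟ j ⟧) ≤ 2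
        fibre≤2 j with Fin.any? (λ a → ¬? (a ∈? I) ×-dec (sq a Fin.≟ j))
        ... | yes (a₀ , a₀∉I , a₀²≡j) = begin
          ∑[ a < N ] (⟦ ¬? (a ∈? I) ⟧ * ⟦ sq a Fin.≟ j ⟧)
            ≤⟨ sum-mono (λ a → ⟦⟧*-≤ (¬? (a ∈? I)) λ _ → ⟦⟧-≤ (sq a Fin.≟ j) λ a²≡j →
                 root a (square-roots a₀∉I (trans a₀²≡j (sym a²≡j)))) ⟩
          ∑[ a < N ] (⟦ a₀ Fin.≟ a ⟧ + ⟦ ⊖ a₀ Fin.≟ a ⟧)
            ≡⟨ ∑-distrib-+ (λ a → ⟦ a₀ Fin.≟ a ⟧) (λ a → ⟦ ⊖ a₀ Fin.≟ a ⟧) ⟩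
          ∑[ a < N ] ⟦ a₀ Fin.≟ a ⟧ + ∑[ a < N ] ⟦ ⊖ a₀ Fin.≟ a ⟧
            ≡⟨ cong₂ _+_ (sum-point a₀) (sum-point (⊖ a₀)) ⟩
          2 ∎
          where
          root : ∀ a → a ≡ a₀ ⊎ a ≡ ⊖ a₀ → 1 ≤ ⟦ a₀ Fin.≟ a ⟧ + ⟦ ⊖ a₀ Fin.≟ a ⟧
          root a (inj₁ refl) = ℕ.≤-trans (ℕ.≤-reflexive (sym (⟦⟧-true (a Fin.≟ a) refl))) (ℕ.m≤m+n _ _)
          root a (inj₂ refl) = ℕ.≤-trans (ℕ.≤-reflexive (sym (⟦⟧-true (⊖ a₀ Fin.≟ ⊖ a₀) refl))) (ℕ.m≤n+m _ _)
        ... | no ∄a = begin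
          ∑[ a < N ] (⟦ ¬? (a ∈? I) ⟧ * ⟦ sq a Fin.≟ j ⟧)
            ≤⟨ sum-mono (λ a → ⟦⟧*-≤ (¬? (a ∈? I)) λ a∉I → ⟦⟧-≤ (sq a Fin.≟ j) λ a²≡j → contradiction (a , a∉I , a²≡j) ∄a) ⟩
          ∑[ a < N ] 0   ≡⟨ sum-replicate-zero N ⟩
          0              ≤⟨ z≤n ⟩
          2              ∎

-- Finite valuation rings

module Codes {c ℓ} (R : FiniteRing c ℓ) where
  open FiniteRing R hiding (zero)
    renaming ( _+_ to infixl 6 _+ᴿ_; _*_ to infixl 7 _*ᴿ_; sum to sumᴿ
             ; refl to ≈-refl; sym to ≈-sym; trans to ≈-trans)
  open SemiringDivisibility semiring using (_,_; _∣0; ∣ʳ-respʳ-≈; x∣ʳy⇒x∣ʳzy)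
  import Relation.Binary.Reasoning.Setoid setoid as ≈-Reasoning

  element-code : ∀ x → element (code x) ≈ x
  element-code = Inverse.strictlyInverseʳ enumeration

  code-element : ∀ i → code (element i) ≡ i
  code-element = Inverse.strictlyInverseˡ enumeration

  code-cong : ∀ {x y} → x ≈ y → code x ≡ code y
  code-cong = Inverse.to-cong enumeration

  element-cong : ∀ {i j} → i ≡ j → element i ≈ element j
  element-cong = Inverse.from-cong enumeration

  element-injective : ∀ {i j} → element i ≈ element j → i ≡ j
  element-injective {i} {j} eq = trans (sym (code-element i)) (trans (code-cong eq) (code-element j))

  -- The ring transported to its codes. Equality becomes propositional, sums over the ring become
  -- sums over `Fin order`, and a `Subset order` is a set of ring elements.
  rawRing′ : RawRing 0ℓ 0ℓ
  rawRing′ = record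
    { Carrier = Fin order
    ; _≈_ = _≡_
    ; _+_ = λ i j → code (element i +ᴿ element j)
    ; _*_ = λ i j → code (element i *ᴿ element j)
    ; -_  = λ i → code (- element i)
    ; 0#  = code 0#
    ; 1#  = code 1#
    }

  element-isRingMonomorphism : IsRingMonomorphism rawRing′ rawRing element
  element-isRingMonomorphism = record
    { isRingHomomorphism = record
      { isSemiringHomomorphism = record
        { isNearSemiringHomomorphism = record
          { +-isMonoidHomomorphism = record
            { isMagmaHomomorphism = record
              { isRelHomomorphism = record { cong = element-cong }
              ; homo = λ i j → element-code _
              }
            ; ε-homo = element-code _
            }
          ; *-homo = λ i j → element-code _
          }
        ; 1#-homo = element-code _
        }
      ; -‿homo = λ i → element-code _
      }
    ; injective = element-injective
    }

  isCommutativeRing′ : let module R′ = RawRing rawRing′ in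
    IsCommutativeRing _≡_ R′._+_ R′._*_ R′.-_ R′.0# R′.1#
  isCommutativeRing′ = RingMonomorphism.isCommutativeRing element-isRingMonomorphism isCommutativeRing

  module F = FiniteCounting isCommutativeRing′
  open RawRing rawRing′ public using ()
    renaming (_+_ to infixl 6 _⊞_; _*_ to infixl 7 _⊠_; 0# to 𝟘; 1# to 𝟙)

  module _ {p} {P : Pred Carrier p} (P? : Decidable P) where

    ∈-comprehension⁺ : ∀ {i} → P (element i) → i ∈ comprehension P?
    ∈-comprehension⁺ {i} Pi = lookup⇒[]= i _ (trans (lookup∘tabulate _ i) (dec-true (P? (element i)) Pi))

    ∈-comprehension⁻ : ∀ {i} → i ∈ comprehension P? → P (element i)
    ∈-comprehension⁻ {i} i∈ with P? (element i) | trans (sym (lookup∘tabulate (does ∘ P? ∘ element) i)) ([]=⇒lookup i∈)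
    ... | yes Pi | _ = Pi

  ∈-⊕ : ∀ {A B i j} → i ∈ A → j ∈ B → i ⊞ j ∈ A ⊕ B
  ∈-⊕ {A} {B} i∈A j∈B = ∈-comprehension⁺
    (λ x → Fin.any? λ i → Fin.any? λ j → (i ∈? A) ×-dec (j ∈? B) ×-dec (element i +ᴿ element j ≈? x))
    (_ , _ , i∈A , j∈B , ≈-sym (element-code _))

  ∈-squares : ∀ {A i} → i ∈ A → i ⊠ i ∈ squares A
  ∈-squares {A} i∈A = ∈-comprehension⁺
    (λ x → Fin.any? λ i → (i ∈? A) ×-dec (element i *ᴿ element i ≈? x))
    (_ , i∈A , ≈-sym (element-code _))

  module _ (n : ℕ) (B : Subset order) where

    IsSum : Pred Carrier ℓ
    IsSum x = ∃ λ (v : Vec (Fin order) n) → (∀ k → lookup v k ∈ B) × sumᴿ (element ∘ lookup v) ≈ x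

    isSum? : Decidable IsSum
    isSum? x = any-vec? n λ v → Fin.all? (λ k → lookup v k ∈? B) ×-dec (sumᴿ (element ∘ lookup v) ≈? x)

  ∈-1-fold : ∀ {B i} → i ∈ B → i ∈ 1 -fold B
  ∈-1-fold {B} {i} i∈B = ∈-comprehension⁺ (isSum? 1 B) (i ∷ [] , (λ { zero → i∈B }) , +-identityʳ _)

  ∈-suc-fold : ∀ {n B i j} → i ∈ B → j ∈ n -fold B → j ⊞ i ∈ suc n -fold B
  ∈-suc-fold {n} {B} {i} {j} i∈B j∈nB with v , v⊆B , Σv≈j ← ∈-comprehension⁻ (isSum? n B) j∈nB =
    ∈-comprehension⁺ (isSum? (suc n) B) (i ∷ v , (λ { zero → i∈B ; (suc k) → v⊆B k }) , (begin
      element i +ᴿ sumᴿ (element ∘ lookup v)  ≈⟨ +-congˡ Σv≈j ⟩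
      element i +ᴿ element j                 ≈⟨ +-comm _ _ ⟩
      element j +ᴿ element i                 ≈⟨ element-code _ ⟨
      element (j ⊞ i)                       ∎))
    where open ≈-Reasoning

  ∣-sum : ∀ {x y w} → x ∣ y → x ∣ w → x ∣ y +ᴿ w
  ∣-sum {x} (a , ax≈y) (b , bx≈w) = a +ᴿ b , ≈-trans (distribʳ x a b) (+-cong ax≈y bx≈w)

  -- The maximal ideal and its complement.

  module Uniformizer {z M} (max : IsMaximalIdeal M) (z-generates : z Generates M) where
    open IsMaximalIdeal max

    ∈M⇒z∣ : ∀ {i} → i ∈ M → z ∣ element i
    ∈M⇒z∣ {i} i∈M = Equivalence.to (z-generates (element i)) (subst (_∈ M) (sym (code-element i)) i∈M)

    z∣⇒∈M : ∀ {i} → z ∣ element i → i ∈ M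
    z∣⇒∈M {i} z∣i = subst (_∈ M) (code-element i) (Equivalence.from (z-generates (element i)) z∣i)

    M-sum : ∀ {i j} → i ∈ M → j ∈ M → i ⊞ j ∈ M
    M-sum i∈M j∈M = z∣⇒∈M (∣ʳ-respʳ-≈ (≈-sym (element-code _)) (∣-sum (∈M⇒z∣ i∈M) (∈M⇒z∣ j∈M)))

    M-multiple : ∀ i {j} → j ∈ M → i ⊠ j ∈ M
    M-multiple i j∈M = z∣⇒∈M (∣ʳ-respʳ-≈ (≈-sym (element-code _)) (x∣ʳy⇒x∣ʳzy (element i) (∈M⇒z∣ j∈M)))

    module _ (d : Carrier) where

      -- Membership in the ideal `(z, d)`. The coefficients are given by codes, so that it can be
      -- decided by search and the ideal is a `Subset`.
      InSpan : Pred Carrier ℓ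
      InSpan x = ∃₂ λ i j → element i *ᴿ z +ᴿ element j *ᴿ d ≈ x

      inSpan? : Decidable InSpan
      inSpan? x = Fin.any? λ i → Fin.any? λ j → element i *ᴿ z +ᴿ element j *ᴿ d ≈? x

      span : Subset order
      span = comprehension inSpan?

      ∈-span⁺ : ∀ a b {x} → a *ᴿ z +ᴿ b *ᴿ d ≈ x → x ∈ᴿ span
      ∈-span⁺ a b eq = ∈-comprehension⁺ inSpan? (code a , code b ,
        ≈-trans (+-cong (*-congʳ (element-code a)) (*-congʳ (element-code b))) (≈-trans eq (≈-sym (element-code _))))

      ∈-span⁻ : ∀ {x} → x ∈ᴿ span → ∃₂ λ a b → a *ᴿ z +ᴿ b *ᴿ d ≈ x
      ∈-span⁻ x∈ with i , j , eq ← ∈-comprehension⁻ inSpan? x∈ = element i , element j , ≈-trans eq (element-code _)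

      span-isIdeal : IsIdeal span
      span-isIdeal = record
        { 0-mem = ∈-span⁺ 0# 0# (≈-trans (+-cong (zeroˡ z) (zeroˡ d)) (+-identityˡ 0#))
        ; +-closed = λ x∈ y∈ → sum∈ (∈-span⁻ x∈) (∈-span⁻ y∈)
        ; *-closed = λ w y∈ → multiple∈ w (∈-span⁻ y∈)
        }
        where
        open import Algebra.Solver.Ring.NaturalCoefficients.Default commutativeSemiring
          using (solve; _:+_; _:*_; _:=_)
        sum∈ : ∀ {x y} → (∃₂ λ a b → a *ᴿ z +ᴿ b *ᴿ d ≈ x) → (∃₂ λ a b → a *ᴿ z +ᴿ b *ᴿ d ≈ y) → x +ᴿ y ∈ᴿ span
        sum∈ (a , b , eq) (a′ , b′ , eq′) = ∈-span⁺ (a +ᴿ a′) (b +ᴿ b′) (≈-trans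
          (solve 6 (λ a b a′ b′ z d → (a :+ a′) :* z :+ (b :+ b′) :* d :=
                                      a :* z :+ b :* d :+ (a′ :* z :+ b′ :* d)) ≈-refl a b a′ b′ z d)
          (+-cong eq eq′))
        multiple∈ : ∀ w {y} → (∃₂ λ a b → a *ᴿ z +ᴿ b *ᴿ d ≈ y) → w *ᴿ y ∈ᴿ span
        multiple∈ w (a , b , eq) = ∈-span⁺ (w *ᴿ a) (w *ᴿ b) (≈-trans
          (solve 5 (λ a b w z d → w :* a :* z :+ w :* b :* d := w :* (a :* z :+ b :* d)) ≈-refl a b w z d)
          (*-congˡ eq))

      M⊆span : M ⊆ span
      M⊆span {i} i∈M with a , az≈i ← ∈M⇒z∣ i∈M = subst (_∈ span) (code-element i)
        (∈-span⁺ a 0# (≈-trans (+-cong az≈i (zeroˡ d)) (+-identityʳ _)))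

      -- The ideal `(z, d)` contains M and also `d`, which M does not. By maximality it is the whole
      -- ring and contains 1.
      ∉M⇒comaximal : ¬ d ∈ᴿ M → ∃₂ λ a b → a *ᴿ z +ᴿ b *ᴿ d ≈ 1#
      ∉M⇒comaximal d∉M with maximal span span-isIdeal M⊆span
      ... | inj₁ span≡M = contradiction
              (subst (d ∈ᴿ_) span≡M (∈-span⁺ 0# 1# (≈-trans (+-cong (zeroˡ z) (*-identityˡ d)) (+-identityˡ d)))) d∉M
      ... | inj₂ span≡⊤ = ∈-span⁻ (subst (1# ∈ᴿ_) (sym span≡⊤) ∈⊤)

    -- d x = 0 gives y = a z y for every multiple y of x, so the factors of z in
    -- z^r x = 0 can be stripped off one by one.
    ∉M⇒regular : ∀ {r} → z ^ᴿ r ≈ 0# → ∀ {d x} → ¬ d ∈ᴿ M → d *ᴿ x ≈ 0# → x ≈ 0#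
    ∉M⇒regular {r} zʳ≈0 {d} {x} d∉M dx≈0 with a , b , az+bd≈1 ← ∉M⇒comaximal d d∉M =
      strip r (≈-trans (*-congʳ zʳ≈0) (zeroˡ x))
      where
      open ≈-Reasoning
      open import Algebra.Solver.Ring.NaturalCoefficients.Default commutativeSemiring
        using (solve; _:+_; _:*_; _:=_)
      strip : ∀ k → z ^ᴿ k *ᴿ x ≈ 0# → x ≈ 0#
      strip zero    x≈0    = ≈-trans (≈-sym (*-identityˡ x)) x≈0
      strip (suc k) zzᵏx≈0 = strip k (begin
        z ^ᴿ k *ᴿ x                                       ≈⟨ *-identityˡ _ ⟨
        1# *ᴿ (z ^ᴿ k *ᴿ x)                                ≈⟨ *-congʳ az+bd≈1 ⟨
        (a *ᴿ z +ᴿ b *ᴿ d) *ᴿ (z ^ᴿ k *ᴿ x)                   ≈⟨ solve 6 (λ a b z d w x → (a :* z :+ b :* d) :* (w :* x) :=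
                                                              a :* ((z :* w) :* x) :+ b :* w :* (d :* x)) ≈-refl a b z d (z ^ᴿ k) x ⟩
        a *ᴿ (z ^ᴿ suc k *ᴿ x) +ᴿ b *ᴿ z ^ᴿ k *ᴿ (d *ᴿ x)      ≈⟨ +-cong (*-congˡ zzᵏx≈0) (*-congˡ dx≈0) ⟩
        a *ᴿ 0# +ᴿ b *ᴿ z ^ᴿ k *ᴿ 0#                         ≈⟨ +-cong (zeroʳ a) (zeroʳ _) ⟩
        0# +ᴿ 0#                                          ≈⟨ +-identityˡ 0# ⟩
        0#                                               ∎)

    ∉M⇒cancel : ∀ {r} → z ^ᴿ r ≈ 0# → ∀ {i j} → i ∉ M → i ⊠ j ≡ 𝟘 → j ≡ 𝟘
    ∉M⇒cancel {r} zʳ≈0 {i} {j} i∉M ij≡0 = element-injective (≈-trans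
      (∉M⇒regular {r} zʳ≈0 (i∉M ∘ subst (_∈ M) (code-element i))
        (≈-trans (≈-sym (element-code _)) (≈-trans (element-cong ij≡0) (element-code 0#))))
      (≈-sym (element-code 0#)))

    -- Every fibre of the residue map is a translate of M. Together with `order ≡ q ^ r` this fixes
    -- `|M| = q^(r−1)`.
    residue-count : ∀ {q} → QuotientHasSize z q → order ≡ q * ∣ M ∣
    residue-count {q} (f , f-cong , f-injective , f-surjective) = begin
      order                                               ≡⟨ ℕ.*-identityʳ order ⟨
      order * 1                                         ≡⟨ sum-const order 1 ⟨
      sum {order} (λ _ → 1)                                 ≡⟨ sum-cong-≗ (λ i → sym (sum-point (f (element i)))) ⟩
      sum {order} (λ i → sum (λ k → ⟦ f (element i) Fin.≟ k ⟧))   ≡⟨ ∑-comm (λ i k → ⟦ f (element i) Fin.≟ k ⟧) ⟩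
      sum (λ k → sum (λ i → ⟦ f (element i) Fin.≟ k ⟧))       ≡⟨ sum-cong-≗ fibre ⟩
      sum {q} (λ _ → ∣ M ∣)                                 ≡⟨ sum-const q (∣ M ∣) ⟩
      q * ∣ M ∣                                         ∎
      where
      open ≡-Reasoning
      fibre : ∀ k → sum (λ i → ⟦ f (element i) Fin.≟ k ⟧) ≡ ∣ M ∣
      fibre k with x , fx≡k ← f-surjective k = begin
        sum (λ i → ⟦ f (element i) Fin.≟ k ⟧)   ≡⟨ sum-cong-≗ (λ i → ⟦⟧-cong (f (element i) Fin.≟ k) (i ⊞ code (- x) ∈? M) (to i) (from i)) ⟩
        sum (λ i → χ M (i ⊞ code (- x)))        ≡⟨ F.sum-translate (χ M) (code (- x)) ⟨
        sum (χ M)                               ≡⟨ sum-χ M ⟩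
        ∣ M ∣                                 ∎
        where
        f[x]≡k : f x ≡ k
        f[x]≡k = fx≡k (∣ʳ-respʳ-≈ (≈-sym (-‿inverseʳ x)) (z ∣0))
        difference : ∀ i → element (i ⊞ code (- x)) ≈ element i - x
        difference i = ≈-trans (element-code _) (+-congˡ (element-code (- x)))
        to : ∀ i → f (element i) ≡ k → i ⊞ code (- x) ∈ M
        to i fi≡k = z∣⇒∈M (∣ʳ-respʳ-≈ (≈-sym (difference i)) (f-injective (trans fi≡k (sym f[x]≡k))))
        from : ∀ i → i ⊞ code (- x) ∈ M → f (element i) ≡ k
        from i i-x∈M = trans (f-cong (∣ʳ-respʳ-≈ (difference i) (∈M⇒z∣ i-x∈M))) f[x]≡k

-- Iteration of the growth step

-- In the application `x k` is the size of the (k+1)-fold sumset of the squares, `S` that of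
-- `A + A`, and `K = N|M|`. The first alternative, once reached, persists, because `a ≤ S` and `x`
-- is monotone; until then the second accumulates one factor `a³` per step.
power-growth : ∀ a S N K (x : ℕ → ℕ) → a ≤ S → a ≤ 4 * x 0 → (∀ k → x k ≤ x (suc k)) →
  (∀ k → N * a ≤ 2 * (S * x (suc k)) ⊎ a * a * (a * x k) ≤ 4 * K * (S * x (suc k))) →
  ∀ k → N * a ^ k ≤ 4 ^ suc k * (x k * S ^ k) ⊎
        a ^ suc (3 * k) ≤ 4 ^ suc k * (x k * S ^ k) * K ^ k
power-growth a S N K x a≤S base mono step zero = inj₂ (begin
  a * 1                   ≡⟨ ℕ.*-identityʳ a ⟩
  a                       ≤⟨ base ⟩
  4 * x 0                 ≡⟨ ones (x 0) ⟩
  4 * 1 * (x 0 * 1) * 1   ∎)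
  where
  open ≤-Reasoning
  ones : ∀ y → 4 * y ≡ 4 * 1 * (y * 1) * 1
  ones = solve-∀
power-growth a S N K x a≤S base mono step (suc k)
  with step k | power-growth a S N K x a≤S base mono step k
... | inj₁ large | _ = inj₁ (begin
  N * (a * a ^ k)                          ≡⟨ ℕ.*-assoc N a (a ^ k) ⟨
  N * a * a ^ k                            ≤⟨ ℕ.*-mono-≤ large (ℕ.^-monoˡ-≤ k a≤S) ⟩
  2 * (S * x (suc k)) * S ^ k              ≡⟨ rearrange S (x (suc k)) (S ^ k) ⟩
  2 * (x (suc k) * (S * S ^ k))            ≤⟨ ℕ.*-monoˡ-≤ (x (suc k) * (S * S ^ k)) 2≤4^ ⟩
  4 ^ suc (suc k) * (x (suc k) * S ^ suc k) ∎)
  where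
  open ≤-Reasoning
  rearrange : ∀ s y t → 2 * (s * y) * t ≡ 2 * (y * (s * t))
  rearrange = solve-∀
  2≤4^ : 2 ≤ 4 ^ suc (suc k)
  2≤4^ = ℕ.≤-trans (s≤s (s≤s z≤n)) (ℕ.m≤m*n 4 (4 ^ suc k) {{ℕ.m^n≢0 4 (suc k)}})
... | inj₂ _ | inj₁ large = inj₁ (begin
  N * (a * a ^ k)                               ≡⟨ rearrange N a (a ^ k) ⟩
  N * a ^ k * a                                 ≤⟨ ℕ.*-mono-≤ large a≤S ⟩
  4 ^ suc k * (x k * S ^ k) * S                 ≤⟨ ℕ.*-monoˡ-≤ S (ℕ.*-monoʳ-≤ (4 ^ suc k) (ℕ.*-monoˡ-≤ (S ^ k) (mono k))) ⟩
  4 ^ suc k * (x (suc k) * S ^ k) * S           ≤⟨ ℕ.m≤n*m (4 ^ suc k * (x (suc k) * S ^ k) * S) 4 ⟩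
  4 * (4 ^ suc k * (x (suc k) * S ^ k) * S)     ≡⟨ rearrange′ (4 ^ suc k) (x (suc k)) (S ^ k) S ⟩
  4 ^ suc (suc k) * (x (suc k) * S ^ suc k)     ∎)
  where
  open ≤-Reasoning
  rearrange : ∀ n b c → n * (b * c) ≡ n * c * b
  rearrange = solve-∀
  rearrange′ : ∀ f y t s → 4 * (f * (y * t) * s) ≡ 4 * f * (y * (s * t))
  rearrange′ = solve-∀
-- The factor `x k` of the induction hypothesis is exactly what `growth` trades, together with `a³`,
-- for `4K · S · x (suc k)`. So only the last `x` remains in the bound.
... | inj₂ growth | inj₂ ih = inj₂ (begin
  a ^ suc (3 * suc k)                                         ≡⟨ cong (λ e → a ^ suc e) (ℕ.*-suc 3 k) ⟩
  a * (a * (a * a ^ suc (3 * k)))                             ≤⟨ ℕ.*-monoʳ-≤ a (ℕ.*-monoʳ-≤ a (ℕ.*-monoʳ-≤ a ih)) ⟩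
  a * (a * (a * (4 ^ suc k * (x k * S ^ k) * K ^ k)))         ≡⟨ rearrange a (4 ^ suc k) (x k) (S ^ k) (K ^ k) ⟩
  a * a * (a * x k) * (4 ^ suc k * S ^ k * K ^ k)             ≤⟨ ℕ.*-monoˡ-≤ (4 ^ suc k * S ^ k * K ^ k) growth ⟩
  4 * K * (S * x (suc k)) * (4 ^ suc k * S ^ k * K ^ k)       ≡⟨ rearrange′ K S (x (suc k)) (4 ^ suc k) (S ^ k) (K ^ k) ⟩
  4 ^ suc (suc k) * (x (suc k) * S ^ suc k) * K ^ suc k       ∎)
  where
  open ≤-Reasoning
  rearrange : ∀ b f y t u → b * (b * (b * (f * (y * t) * u))) ≡ b * b * (b * y) * (f * t * u)
  rearrange = solve-∀
  rearrange′ : ∀ c s y f t u → 4 * c * (s * y) * (f * t * u) ≡ 4 * f * (y * (s * t)) * (c * u)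
  rearrange′ = solve-∀

-- From natural numbers to rationals.

/-mono-≤ : ∀ a b c d .{{_ : NonZero b}} .{{_ : NonZero d}} → a * d ≤ c * b → (+ a / b) ℚ.≤ (+ c / d)
/-mono-≤ a (suc b) c (suc d) ad≤cb = ℚ.toℚᵘ-cancel-≤ (begin
  toℚᵘ (+ a / suc b)   ≃⟨ ℚ.toℚᵘ-fromℚᵘ (mkℚᵘ (+ a) b) ⟩
  mkℚᵘ (+ a) b           ≤⟨ *≤* (subst₂ ℤ._≤_ (ℤ.pos-* a (suc d)) (ℤ.pos-* c (suc b)) (+≤+ ad≤cb)) ⟩
  mkℚᵘ (+ c) d           ≃⟨ ℚ.toℚᵘ-fromℚᵘ (mkℚᵘ (+ c) d) ⟨
  toℚᵘ (+ c / suc d)   ∎)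
  where open ℚᵘ.≤-Reasoning

fromℕ-* : ∀ m n → fromℕ (m * n) ≡ fromℕ m ℚ.* fromℕ n
fromℕ-* m n = ℚ.toℚᵘ-injective (begin
  toℚᵘ (fromℕ (m * n))               ≈⟨ ℚ.toℚᵘ-fromℚᵘ (mkℚᵘ (+ (m * n)) 0) ⟩
  mkℚᵘ (+ (m * n)) 0                 ≈⟨ *≡* (cong (ℤ._* + 1) (ℤ.pos-* m n)) ⟩
  mkℚᵘ (+ m) 0 ℚᵘ.* mkℚᵘ (+ n) 0     ≈⟨ ℚᵘ.*-cong (ℚ.toℚᵘ-fromℚᵘ (mkℚᵘ (+ m) 0)) (ℚ.toℚᵘ-fromℚᵘ (mkℚᵘ (+ n) 0)) ⟨
  toℚᵘ (fromℕ m) ℚᵘ.* toℚᵘ (fromℕ n) ≈⟨ ℚ.toℚᵘ-homo-* (fromℕ m) (fromℕ n) ⟨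
  toℚᵘ (fromℕ m ℚ.* fromℕ n)         ∎)
  where open ℚᵘ.≃-Reasoning

¼ : ℚ
¼ = + 1 / 4

-- Each factor ¼ cancels one factor 4. The rational `p` is arbitrary because the recursive call is
-- made at `¼ · p`.
¼^-bound : ∀ n {p T} → p ℚ.≤ fromℕ (4 ^ n * T) → (¼ ^ℚ n) ℚ.* p ℚ.≤ fromℕ T
¼^-bound zero {p} {T} p≤T = begin
  ℚ.1ℚ ℚ.* p         ≡⟨ ℚ.*-identityˡ p ⟩
  p                  ≤⟨ p≤T ⟩
  fromℕ (1 * T)      ≡⟨ cong fromℕ (ℕ.*-identityˡ T) ⟩
  fromℕ T            ∎
  where open ℚ.≤-Reasoning
¼^-bound (suc n) {p} {T} p≤4ⁿT = begin
  ¼ ℚ.* (¼ ^ℚ n) ℚ.* p     ≡⟨ cong (ℚ._* p) (ℚ.*-comm ¼ (¼ ^ℚ n)) ⟩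
  (¼ ^ℚ n) ℚ.* ¼ ℚ.* p     ≡⟨ ℚ.*-assoc (¼ ^ℚ n) ¼ p ⟩
  (¼ ^ℚ n) ℚ.* (¼ ℚ.* p)   ≤⟨ ¼^-bound n quarter ⟩
  fromℕ T                  ∎
  where
  open ℚ.≤-Reasoning
  quarter : ¼ ℚ.* p ℚ.≤ fromℕ (4 ^ n * T)
  quarter = begin
    ¼ ℚ.* p                                ≤⟨ ℚ.*-monoˡ-≤-nonNeg ¼ p≤4ⁿT ⟩
    ¼ ℚ.* fromℕ (4 * 4 ^ n * T)            ≡⟨ cong (λ m → ¼ ℚ.* fromℕ m) (ℕ.*-assoc 4 (4 ^ n) T) ⟩
    ¼ ℚ.* fromℕ (4 * (4 ^ n * T))          ≡⟨ cong (¼ ℚ.*_) (fromℕ-* 4 (4 ^ n * T)) ⟩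
    ¼ ℚ.* (fromℕ 4 ℚ.* fromℕ (4 ^ n * T))  ≡⟨ ℚ.*-assoc ¼ (fromℕ 4) (fromℕ (4 ^ n * T)) ⟨
    ℚ.1ℚ ℚ.* fromℕ (4 ^ n * T)             ≡⟨ ℚ.*-identityˡ (fromℕ (4 ^ n * T)) ⟩
    fromℕ (4 ^ n * T)                      ∎

min-bound : ∀ n a b d {T} .{{_ : NonZero d}} → a ≤ 4 ^ n * T ⊎ b ≤ 4 ^ n * T * d →
            (¼ ^ℚ n) ℚ.* (fromℕ a ℚ.⊓ (+ b / d)) ℚ.≤ fromℕ T
min-bound n a b d {T} (inj₁ a≤) = ¼^-bound n (ℚ.≤-trans (ℚ.p⊓q≤p (fromℕ a) (+ b / d))
  (/-mono-≤ a 1 (4 ^ n * T) 1 (ℕ.*-monoˡ-≤ 1 a≤)))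
min-bound n a b d {T} (inj₂ b≤) = ¼^-bound n (ℚ.≤-trans (ℚ.p⊓q≤q (fromℕ a) (+ b / d))
  (/-mono-≤ b d (4 ^ n * T) 1 (subst (_≤ 4 ^ n * T * d) (sym (ℕ.*-identityʳ b)) b≤)))

-- Assembly for finite valuation rings.

nonempty : ∀ {n} (A : Subset n) → 0 < ∣ A ∣ → Nonempty A
nonempty {n} A 0<∣A∣ with nonempty? A
... | yes ne = ne
... | no  ¬ne = contradiction (trans (cong ∣_∣ (Empty-unique ¬ne)) (∣⊥∣≡0 n)) (ℕ.>⇒≢ 0<∣A∣)

module _ {c ℓ} (R : FiniteValuationRing c ℓ) where
  open FiniteValuationRing R using
    (finiteRing; order; IsUniformizer; QuotientHasSize; IsNilpotencyIndex; _⊕_; squares; _-fold_)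
  open Codes finiteRing

  sumset-growth : ∀ {z q r′} .{{_ : NonZero q}} → let r = suc r′ in
    IsUniformizer z → QuotientHasSize z q → IsNilpotencyIndex z r → order ≡ q ^ r → IsOddPrimePower q →
    (A : Subset order) → 2 * q ^ r′ ≤ ∣ A ∣ → ∀ k →
    let x = ∣ suc k -fold squares A ∣; S = ∣ A ⊕ A ∣ in
    q ^ r * ∣ A ∣ ^ k ≤ 4 ^ suc k * (x * S ^ k) ⊎
    ∣ A ∣ ^ suc (3 * k) ≤ 4 ^ suc k * (x * S ^ k) * (q ^ r * q ^ r′) ^ k
  sumset-growth {z} {q} {r′} (M , max , z-generates) quotient (_ , zʳ≈0 , _) order≡qʳ odd-q A 2∣M∣≤∣A∣ =
    power-growth (∣ A ∣) (∣ A ⊕ A ∣) (q ^ r) (q ^ r * q ^ r′) x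
      (F.translate⊆⇒≤ a₀ λ a∈A → ∈-⊕ a∈A a₀∈A) base mono step
    where
    open ≤-Reasoning
    open Uniformizer max z-generates
    r : ℕ
    r = suc r′
    x : ℕ → ℕ
    x k = ∣ suc k -fold squares A ∣
    ∣M∣≡qʳ⁻¹ : ∣ M ∣ ≡ q ^ r′
    ∣M∣≡qʳ⁻¹ = ℕ.*-cancelˡ-≡ (∣ M ∣) (q ^ r′) q (trans (sym (residue-count quotient)) order≡qʳ)
    odd-order : Odd order
    odd-order = subst Odd (sym order≡qʳ) (odd-^ r (odd-prime-power odd-q))
    half : ∃ λ t → t ⊞ t ≡ 𝟙
    half = F.odd-order⇒½ odd-order
    module L = F.LocalRing M (∉M⇒cancel {r} zʳ≈0) (proj₁ half) (proj₂ half)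
    0<∣A∣ : 0 < ∣ A ∣
    0<∣A∣ = ℕ.<-≤-trans (ℕ.>-nonZero⁻¹ (2 * q ^ r′) {{ℕ.m*n≢0 2 (q ^ r′) {{_}} {{m^n≢0 q r′}}}}) 2∣M∣≤∣A∣
    a₀ = proj₁ (nonempty A 0<∣A∣)
    a₀∈A = proj₂ (nonempty A 0<∣A∣)
    -- Doubling `|A| ≤ |M| + 2 * x 0` produces `2|M|`, which the size hypothesis on A absorbs into
    -- one of the two copies of `|A|`.
    base : ∣ A ∣ ≤ 4 * x 0
    base = ℕ.+-cancelˡ-≤ (∣ A ∣) _ _ (begin
      ∣ A ∣ + ∣ A ∣                    ≤⟨ ℕ.+-mono-≤ bound bound ⟩
      q ^ r′ + 2 * x 0 + (q ^ r′ + 2 * x 0)  ≡⟨ regroup (q ^ r′) (x 0) ⟩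
      2 * q ^ r′ + 4 * x 0             ≤⟨ ℕ.+-monoˡ-≤ (4 * x 0) 2∣M∣≤∣A∣ ⟩
      ∣ A ∣ + 4 * x 0                  ∎)
      where
      bound : ∣ A ∣ ≤ q ^ r′ + 2 * x 0
      bound = subst (λ m → ∣ A ∣ ≤ m + 2 * x 0) ∣M∣≡qʳ⁻¹
        (L.squares-bound M-sum M-multiple A (1 -fold squares A) (λ a∈A → ∈-1-fold (∈-squares a∈A)))
      regroup : ∀ m y → m + 2 * y + (m + 2 * y) ≡ 2 * m + 4 * y
      regroup = solve-∀
    mono : ∀ k → x k ≤ x (suc k)
    mono k = F.translate⊆⇒≤ (a₀ ⊠ a₀) (∈-suc-fold (∈-squares a₀∈A))
    0<x : ∀ k → 0 < x k
    0<x ℕ.zero = ℕ.n≢0⇒n>0 λ x₀≡0 → ℕ.n≮0 (ℕ.<-≤-trans 0<∣A∣ (ℕ.≤-trans base (ℕ.≤-reflexive (cong (4 *_) x₀≡0))))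
    0<x (suc k) = ℕ.<-≤-trans (0<x k) (mono k)
    0<S : 0 < ∣ A ⊕ A ∣
    0<S = ℕ.<-≤-trans 0<∣A∣ (F.translate⊆⇒≤ a₀ λ a∈A → ∈-⊕ a∈A a₀∈A)
    step : ∀ k → q ^ r * ∣ A ∣ ≤ 2 * (∣ A ⊕ A ∣ * x (suc k)) ⊎
                 ∣ A ∣ * ∣ A ∣ * (∣ A ∣ * x k) ≤ 4 * (q ^ r * q ^ r′) * (∣ A ⊕ A ∣ * x (suc k))
    step k = Sum.map (subst (λ N → N * ∣ A ∣ ≤ 2 * (∣ A ⊕ A ∣ * x (suc k))) order≡qʳ)
      (subst (λ K → ∣ A ∣ * ∣ A ∣ * (∣ A ∣ * x k) ≤ 4 * K * (∣ A ⊕ A ∣ * x (suc k))) (cong₂ _*_ order≡qʳ ∣M∣≡qʳ⁻¹))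
      (L.sum-product A (suc k -fold squares A) (A ⊕ A) (suc (suc k) -fold squares A)
        {{subst NonZero (sym order≡qʳ) (m^n≢0 q r)}}
        {{ℕ.m*n≢0 (∣ A ∣) (x k) {{ℕ.>-nonZero 0<∣A∣}} {{ℕ.>-nonZero (0<x k)}}}}
        {{ℕ.m*n≢0 (∣ A ⊕ A ∣) (x (suc k)) {{ℕ.>-nonZero 0<S}} {{ℕ.>-nonZero (0<x (suc k))}}}}
        ∈-⊕ (λ a∈A → ∈-suc-fold (∈-squares a∈A)))

theorem1p7 : ∀ {c ℓ} (n : ℕ) → 1 < n →
    ∃ λ (C : ℚ) → 0ℚ ℚ.< C ×
    ((R : FiniteValuationRing c ℓ) →
    let module R = FiniteValuationRing R in
    (z : R.Carrier) (q r : ℕ) .{{_ : NonZero q}} →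
    R.IsUniformizer z → R.QuotientHasSize z q → R.IsNilpotencyIndex z r →
    R.order ≡ q ^ r → IsOddPrimePower q →
    (A : Subset R.order) → 2 * q ^ (r ∸ 1) ≤ ∣ A ∣ →
    fromℕ ((∣ n R.-fold R.squares A ∣ ⊔ ∣ A R.⊕ A ∣) ^ n)
    ℚ.≥ (C ^ℚ n) ℚ.* (fromℕ (q ^ r * ∣ A ∣ ^ (n ∸ 1))
    ℚ.⊓ _/_ (+ (∣ A ∣ ^ (3 * n ∸ 2))) (q ^ ((n ∸ 1) * (2 * r ∸ 1))) {{m^n≢0 q ((n ∸ 1) * (2 * r ∸ 1))}}))
theorem1p7 (suc k) 1<n = ¼ , ℚ.positive⁻¹ ¼ , bound
  where
  bound : (R : FiniteValuationRing _ _) →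
    let module R = FiniteValuationRing R in
    (z : R.Carrier) (q r : ℕ) .{{_ : NonZero q}} →
    R.IsUniformizer z → R.QuotientHasSize z q → R.IsNilpotencyIndex z r →
    R.order ≡ q ^ r → IsOddPrimePower q →
    (A : Subset R.order) → 2 * q ^ (r ∸ 1) ≤ ∣ A ∣ →
    fromℕ ((∣ suc k R.-fold R.squares A ∣ ⊔ ∣ A R.⊕ A ∣) ^ suc k)
    ℚ.≥ (¼ ^ℚ suc k) ℚ.* (fromℕ (q ^ r * ∣ A ∣ ^ k)
    ℚ.⊓ _/_ (+ (∣ A ∣ ^ (3 * suc k ∸ 2))) (q ^ (k * (2 * r ∸ 1))) {{m^n≢0 q (k * (2 * r ∸ 1))}})
  bound R z q ℕ.zero _ _ (() , _)
  bound R z q r@(suc r′) uniformizer quotient nilpotency order≡qʳ odd-q A 2∣M∣≤∣A∣ =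
    min-bound (suc k) (q ^ r * ∣ A ∣ ^ k) (∣ A ∣ ^ (3 * suc k ∸ 2)) (q ^ (k * (2 * r ∸ 1)))
      {{m^n≢0 q (k * (2 * r ∸ 1))}}
      (Sum.map (λ le → ℕ.≤-trans le 4ˣSᵏ≤) second
        (sumset-growth R uniformizer quotient nilpotency order≡qʳ odd-q A 2∣M∣≤∣A∣ k))
    where
    open FiniteValuationRing R using (_⊕_; _-fold_; squares)
    open ≤-Reasoning
    x S y : ℕ
    x = ∣ suc k -fold squares A ∣
    S = ∣ A ⊕ A ∣
    y = x ⊔ S
    -- One factor `x` and k factors `S` make up `n = k + 1` factors, each at most the maximum `y`.
    -- This is where the n-th power of the maximum comes from.
    4ˣSᵏ≤ : 4 ^ suc k * (x * S ^ k) ≤ 4 ^ suc k * y ^ suc k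
    4ˣSᵏ≤ = ℕ.*-monoʳ-≤ (4 ^ suc k) (ℕ.*-mono-≤ (ℕ.m≤m⊔n x S) (ℕ.^-monoˡ-≤ k (ℕ.m≤n⊔m x S)))
    -- Here `2r − 1 = r + r′` with `r′ = r − 1`, the exponent of q in `N|M|`.
    exponent : q ^ (k * (2 * r ∸ 1)) ≡ (q ^ r * q ^ r′) ^ k
    exponent = begin-equality
      q ^ (k * (2 * r ∸ 1))      ≡⟨ cong (q ^_) (trans (ℕ.*-comm k (2 * r ∸ 1)) (cong (_* k) (twice r′))) ⟩
      q ^ ((r + r′) * k)         ≡⟨ ℕ.^-*-assoc q (r + r′) k ⟨
      (q ^ (r + r′)) ^ k         ≡⟨ cong (_^ k) (ℕ.^-distribˡ-+-* q r r′) ⟩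
      (q ^ r * q ^ r′) ^ k       ∎
      where
      twice : ∀ r′ → r′ + suc (r′ + 0) ≡ suc r′ + r′
      twice = solve-∀
    second : ∣ A ∣ ^ suc (3 * k) ≤ 4 ^ suc k * (x * S ^ k) * (q ^ r * q ^ r′) ^ k →
             ∣ A ∣ ^ (3 * suc k ∸ 2) ≤ 4 ^ suc k * y ^ suc k * q ^ (k * (2 * r ∸ 1))
    second le = begin
      ∣ A ∣ ^ (3 * suc k ∸ 2)                                ≡⟨ cong (λ e → ∣ A ∣ ^ (e ∸ 2)) (ℕ.*-suc 3 k) ⟩
      ∣ A ∣ ^ suc (3 * k)                                    ≤⟨ le ⟩
      4 ^ suc k * (x * S ^ k) * (q ^ r * q ^ r′) ^ k         ≤⟨ ℕ.*-monoˡ-≤ ((q ^ r * q ^ r′) ^ k) 4ˣSᵏ≤ ⟩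
      4 ^ suc k * y ^ suc k * (q ^ r * q ^ r′) ^ k           ≡⟨ cong (4 ^ suc k * y ^ suc k *_) exponent ⟨
      4 ^ suc k * y ^ suc k * q ^ (k * (2 * r ∸ 1))          ∎
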